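{- The map assigning to each matroid $\mathsf{M}$ its Whitney polynomial $\mathrm{W}_{\mathsf{M}}(t)\in\mathbb{Z}[t]$ is a valuative invariant.
   Context: All matroids have finite ground sets contained in the positive integers. For a matroid $\mathsf{M}$ of rank $k$, the $i$-th Whitney number of the second kind $W_i$ is the number of flats of $\mathsf{M}$ of rank $i$, and the Whitney polynomial is $\mathrm{W}_{\mathsf{M}}(t)=\sum_{i=0}^k W_i\,t^i$. The base polytope of a matroid $\mathsf{M}$ on $E$ with bases $\mathscr{B}$ is $\mathscr{P}(\mathsf{M})=\operatorname{conv}\{\sum_{i\in B}e_i : B\in\mathscr{B}\}\subseteq\mathbb{R}^E$, with indicator function $\mathbf{1}_{\mathscr{P}(\mathsf{M})}:\mathbb{R}^E\to\mathbb{Z}$. A map $f$ from matroids to an abelian group is a valuation if $\sum_{i}a_if(\mathsf{M}_i)=0$ whenever $\mathsf{M}_1,\dots,\mathsf{M}_s$ are matroids on a common ground set and $a_i\in\mathbb{Z}$ satisfy $\sum_i a_i\mathbf{1}_{\mathscr{P}(\mathsf{M}_i)}=0$. (This is known to be equivalent to the inclusion–exclusion property under matroid subdivisions.) A valuative invariant is a valuation with $f(\mathsf{M})=f(\mathsf{N})$ whenever $\mathsf{M}\cong\mathsf{N}$. -}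

module Defs where

open import Algebra.Bundles using (AbelianGroup; RawMonoid)
import Algebra.Definitions.RawMonoid as RawMonoidDefinitions
open import Data.Bool.Base using (if_then_else_)
open import Data.Fin.Base using (Fin; toℕ)
import Data.Fin.Properties as Fin
open import Data.Fin.Subset
  using (Subset; inside; outside; _∈_; _∉_; _∩_; _∪_; _-_; ⁅_⁆; ⊤; ∣_∣)
open import Data.Fin.Subset.Properties using (_∈?_)
open import Data.Integer.Base as ℤ using (ℤ; +_; -[1+_]; 0ℤ; 1ℤ)
import Data.Integer.Properties as ℤ
open import Data.List.Base as List using (List; []; _∷_; _++_; length; filter)
open import Data.List.Extrema.Nat using (max)
open import Data.List.Relation.Unary.All using (All)
open import Data.List.Relation.Unary.Linked using (Linked)
open import Data.Nat.Base as ℕ using (ℕ; zero; suc)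
import Data.Nat.Properties as ℕ
open import Data.Product.Base using (∃; Σ-syntax; _×_; _,_; proj₁; proj₂)
open import Data.Rational.Base as ℚ using (ℚ; 0ℚ; 1ℚ; ½)
import Data.Rational.Properties as ℚ
open import Data.Rational.Solver using (module +-*-Solver)
open import Data.Vec.Base as Vec using ([]; _∷_)
open import Data.Vec.Functional using (Vector)
open import Function.Base using (_∘_)
open import Function.Bundles using (_⇔_; _↔_; Inverse)
open import Level as Level using (Level; 0ℓ; _⊔_)
open import Relation.Binary.PropositionalEquality
  using (_≡_; refl; sym; trans; cong; cong₂; subst)
open import Relation.Nullary.Decidable
  using (does; dec-false; ¬?; _→-dec_; _×-dec_)
open import Relation.Unary using (Pred; Decidable)
import Relation.Unary as U

private
  1ℓ : Level
  1ℓ = Level.suc 0ℓ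

  variable
    a c ℓ : Level
    n : ℕ

------------------------------------------------------------------------
-- Real numbers: Cauchy sequences of rationals, compared up to
-- sequences tending to zero.

record ℝ : Set where
  field
    seq    : ℕ → ℚ
    cauchy : ∀ ε → 0ℚ ℚ.< ε →
             ∃ λ N → ∀ m n → N ℕ.≤ m → N ℕ.≤ n → ℚ.∣ seq m ℚ.- seq n ∣ ℚ.< ε

open ℝ public

infix 4 _≈ᵣ_ _≤ᵣ_

_≈ᵣ_ : ℝ → ℝ → Set
x ≈ᵣ y = ∀ ε → 0ℚ ℚ.< ε →
         ∃ λ N → ∀ n → N ℕ.≤ n → ℚ.∣ seq x n ℚ.- seq y n ∣ ℚ.< ε

_≤ᵣ_ : ℝ → ℝ → Set
x ≤ᵣ y = ∀ ε → 0ℚ ℚ.< ε →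
         ∃ λ N → ∀ n → N ℕ.≤ n → seq x n ℚ.≤ seq y n ℚ.+ ε

fromℚ : ℚ → ℝ
fromℚ q = record
  { seq    = λ _ → q
  ; cauchy = λ ε 0<ε → 0 , λ _ _ _ _ →
      subst (ℚ._< ε) (sym (cong ℚ.∣_∣ (ℚ.+-inverseʳ q))) 0<ε
  }

0ᵣ 1ᵣ : ℝ
0ᵣ = fromℚ 0ℚ
1ᵣ = fromℚ 1ℚ

private
  half-pos : ∀ ε → 0ℚ ℚ.< ε → 0ℚ ℚ.< ½ ℚ.* ε
  half-pos ε 0<ε =
    subst (ℚ._< ½ ℚ.* ε) (ℚ.*-zeroʳ ½) (ℚ.*-monoʳ-<-pos ½ 0<ε)

  half+half : ∀ ε → ½ ℚ.* ε ℚ.+ ½ ℚ.* ε ≡ ε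
  half+half ε =
    trans (sym (ℚ.*-distribʳ-+ ε ½ ½)) (ℚ.*-identityˡ ε)

  sum-diff : ∀ x y x′ y′ →
             (x ℚ.+ y) ℚ.- (x′ ℚ.+ y′) ≡ (x ℚ.- x′) ℚ.+ (y ℚ.- y′)
  sum-diff = solve 4 (λ x y x′ y′ →
    (x :+ y) :- (x′ :+ y′) := (x :- x′) :+ (y :- y′)) refl
    where open +-*-Solver

  product-diff : ∀ x y x′ y′ →
                 x ℚ.* y ℚ.- x′ ℚ.* y′ ≡ x ℚ.* (y ℚ.- y′) ℚ.+ y′ ℚ.* (x ℚ.- x′)
  product-diff = solve 4 (λ x y x′ y′ →
    x :* y :- x′ :* y′ := x :* (y :- y′) :+ y′ :* (x :- x′)) refl
    where open +-*-Solver

  diff-add : ∀ x y → x ≡ y ℚ.+ (x ℚ.- y)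
  diff-add = solve 2 (λ x y → x := y :+ (x :- y)) refl
    where open +-*-Solver

  bounded : (x : ℝ) → ∃ λ B → ∃ λ N →
            ℚ.Positive B × (∀ n → N ℕ.≤ n → ℚ.∣ seq x n ∣ ℚ.≤ B)
  bounded x with cauchy x 1ℚ (ℚ.positive⁻¹ 1ℚ)
  ... | N , close = B , N , ℚ.positive 0<B , bound
    where
    B : ℚ
    B = ℚ.∣ seq x N ∣ ℚ.+ 1ℚ
    0<B : 0ℚ ℚ.< B
    0<B = ℚ.+-mono-≤-< (ℚ.0≤∣p∣ (seq x N)) (ℚ.positive⁻¹ 1ℚ)
    bound : ∀ n → N ℕ.≤ n → ℚ.∣ seq x n ∣ ℚ.≤ B
    bound n N≤n = begin
      ℚ.∣ seq x n ∣
        ≡⟨ cong ℚ.∣_∣ (diff-add (seq x n) (seq x N)) ⟩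
      ℚ.∣ seq x N ℚ.+ (seq x n ℚ.- seq x N) ∣
        ≤⟨ ℚ.∣p+q∣≤∣p∣+∣q∣ (seq x N) (seq x n ℚ.- seq x N) ⟩
      ℚ.∣ seq x N ∣ ℚ.+ ℚ.∣ seq x n ℚ.- seq x N ∣
        ≤⟨ ℚ.+-monoʳ-≤ ℚ.∣ seq x N ∣ (ℚ.<⇒≤ (close n N N≤n ℕ.≤-refl)) ⟩
      B ∎
      where open ℚ.≤-Reasoning

  scale : ∀ B → .{{ℚ.Positive B}} → ∀ ε → 0ℚ ℚ.< ε →
          ∃ λ δ → 0ℚ ℚ.< δ ×
          (∀ p q → ℚ.∣ p ∣ ℚ.≤ B → ℚ.∣ q ∣ ℚ.< δ → ℚ.∣ p ℚ.* q ∣ ℚ.< ε)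
  scale B ε 0<ε = δ , 0<δ , small
    where
    instance
      B≢0 : ℚ.NonZero B
      B≢0 = ℚ.pos⇒nonZero B
    δ : ℚ
    δ = ℚ.1/ B ℚ.* ε
    0<δ : 0ℚ ℚ.< δ
    0<δ = subst (ℚ._< δ) (ℚ.*-zeroʳ (ℚ.1/ B))
            (ℚ.*-monoʳ-<-pos (ℚ.1/ B) {{ℚ.1/pos⇒pos B}} 0<ε)
    B*δ : B ℚ.* δ ≡ ε
    B*δ = trans (sym (ℚ.*-assoc B (ℚ.1/ B) ε))
            (trans (cong (ℚ._* ε) (ℚ.*-inverseʳ B)) (ℚ.*-identityˡ ε))
    small : ∀ p q → ℚ.∣ p ∣ ℚ.≤ B → ℚ.∣ q ∣ ℚ.< δ → ℚ.∣ p ℚ.* q ∣ ℚ.< ε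
    small p q p≤B q<δ = begin-strict
      ℚ.∣ p ℚ.* q ∣
        ≡⟨ ℚ.∣p*q∣≡∣p∣*∣q∣ p q ⟩
      ℚ.∣ p ∣ ℚ.* ℚ.∣ q ∣
        ≤⟨ ℚ.*-monoʳ-≤-nonNeg ℚ.∣ q ∣ {{ℚ.∣-∣-nonNeg q}} p≤B ⟩
      B ℚ.* ℚ.∣ q ∣
        <⟨ ℚ.*-monoʳ-<-pos B q<δ ⟩
      B ℚ.* δ
        ≡⟨ B*δ ⟩
      ε ∎
      where open ℚ.≤-Reasoning

  add-small : ∀ ε p q → ℚ.∣ p ∣ ℚ.< ½ ℚ.* ε → ℚ.∣ q ∣ ℚ.< ½ ℚ.* ε →
              ℚ.∣ p ℚ.+ q ∣ ℚ.< ε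
  add-small ε p q p< q< = begin-strict
    ℚ.∣ p ℚ.+ q ∣            ≤⟨ ℚ.∣p+q∣≤∣p∣+∣q∣ p q ⟩
    ℚ.∣ p ∣ ℚ.+ ℚ.∣ q ∣      <⟨ ℚ.+-mono-< p< q< ⟩
    ½ ℚ.* ε ℚ.+ ½ ℚ.* ε      ≡⟨ half+half ε ⟩
    ε                        ∎
    where open ℚ.≤-Reasoning

infixl 6 _+ᵣ_
infixl 7 _*ᵣ_

_+ᵣ_ : ℝ → ℝ → ℝ
seq (x +ᵣ y) n = seq x n ℚ.+ seq y n
cauchy (x +ᵣ y) ε 0<ε =
  let N₁ , close₁ = cauchy x (½ ℚ.* ε) (half-pos ε 0<ε)
      N₂ , close₂ = cauchy y (½ ℚ.* ε) (half-pos ε 0<ε)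
  in N₁ ℕ.⊔ N₂ , λ m n N≤m N≤n →
  subst (λ d → ℚ.∣ d ∣ ℚ.< ε)
    (sym (sum-diff (seq x m) (seq y m) (seq x n) (seq y n)))
    (add-small ε (seq x m ℚ.- seq x n) (seq y m ℚ.- seq y n)
      (close₁ m n (ℕ.m⊔n≤o⇒m≤o N₁ N₂ N≤m) (ℕ.m⊔n≤o⇒m≤o N₁ N₂ N≤n))
      (close₂ m n (ℕ.m⊔n≤o⇒n≤o N₁ N₂ N≤m) (ℕ.m⊔n≤o⇒n≤o N₁ N₂ N≤n)))

_*ᵣ_ : ℝ → ℝ → ℝ
seq (x *ᵣ y) n = seq x n ℚ.* seq y n
cauchy (x *ᵣ y) ε 0<ε =
  let B₁ , K₁ , pos₁ , bound₁ = bounded x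
      B₂ , K₂ , pos₂ , bound₂ = bounded y
      δ₁ , 0<δ₁ , small₁ = scale B₁ {{pos₁}} (½ ℚ.* ε) (half-pos ε 0<ε)
      δ₂ , 0<δ₂ , small₂ = scale B₂ {{pos₂}} (½ ℚ.* ε) (half-pos ε 0<ε)
      N₁ , close₁ = cauchy y δ₁ 0<δ₁
      N₂ , close₂ = cauchy x δ₂ 0<δ₂
  in (K₁ ℕ.⊔ K₂) ℕ.⊔ (N₁ ℕ.⊔ N₂) , λ m n ≤m ≤n →
  let K≤m = ℕ.m⊔n≤o⇒m≤o (K₁ ℕ.⊔ K₂) (N₁ ℕ.⊔ N₂) ≤m
      K≤n = ℕ.m⊔n≤o⇒m≤o (K₁ ℕ.⊔ K₂) (N₁ ℕ.⊔ N₂) ≤n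
      N≤m = ℕ.m⊔n≤o⇒n≤o (K₁ ℕ.⊔ K₂) (N₁ ℕ.⊔ N₂) ≤m
      N≤n = ℕ.m⊔n≤o⇒n≤o (K₁ ℕ.⊔ K₂) (N₁ ℕ.⊔ N₂) ≤n
  in
  subst (λ d → ℚ.∣ d ∣ ℚ.< ε)
    (sym (product-diff (seq x m) (seq y m) (seq x n) (seq y n)))
    (add-small ε (seq x m ℚ.* (seq y m ℚ.- seq y n))
                 (seq y n ℚ.* (seq x m ℚ.- seq x n))
      (small₁ (seq x m) (seq y m ℚ.- seq y n)
        (bound₁ m (ℕ.m⊔n≤o⇒m≤o K₁ K₂ K≤m))
        (close₁ m n (ℕ.m⊔n≤o⇒m≤o N₁ N₂ N≤m) (ℕ.m⊔n≤o⇒m≤o N₁ N₂ N≤n)))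
      (small₂ (seq y n) (seq x m ℚ.- seq x n)
        (bound₂ n (ℕ.m⊔n≤o⇒n≤o K₁ K₂ K≤n))
        (close₂ m n (ℕ.m⊔n≤o⇒n≤o N₁ N₂ N≤m) (ℕ.m⊔n≤o⇒n≤o N₁ N₂ N≤n))))

+ᵣ-rawMonoid : RawMonoid 0ℓ 0ℓ
+ᵣ-rawMonoid = record { Carrier = ℝ ; _≈_ = _≈ᵣ_ ; _∙_ = _+ᵣ_ ; ε = 0ᵣ }

open RawMonoidDefinitions +ᵣ-rawMonoid using () renaming (sum to ∑ᵣ)
open RawMonoidDefinitions ℤ.+-0-rawMonoid using () renaming (sum to ∑ℤ)

------------------------------------------------------------------------
-- Convex hulls and indicator functions

-- The convex hull of the set of values of a family of points of ℝⁿ.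
conv : {I : Set} → (I → Vector ℝ n) → Pred (Vector ℝ n) 0ℓ
conv {I = I} p x =
  ∃ λ m → Σ[ j ∈ Vector I m ] Σ[ w ∈ Vector ℝ m ]
    (∀ k → 0ᵣ ≤ᵣ w k) ×
    ∑ᵣ w ≈ᵣ 1ᵣ ×
    (∀ i → x i ≈ᵣ ∑ᵣ (λ k → w k *ᵣ p (j k) i))

-- The graph of the indicator function of P: Indicator P x v says that
-- 1_P(x) = v.  A relation is used because membership in a subset of ℝⁿ
-- is not decidable constructively.
data Indicator {A : Set a} (P : Pred A ℓ) (x : A) : ℤ → Set (a ⊔ ℓ) where
  inside  : x U.∈ P → Indicator P x 1ℤ
  outside : x U.∉ P → Indicator P x 0ℤ

------------------------------------------------------------------------
-- Matroids

-- A finite set of positive integers, as its increasing enumeration.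
record GroundSet : Set where
  field
    elements   : List ℕ
    increasing : Linked ℕ._<_ elements
    positive   : All (0 ℕ.<_) elements

  size : ℕ
  size = length elements

open GroundSet public using (size)

-- The i-th smallest element of E is represented by its position
-- i : Fin (size E), so that subsets of E are Subset (size E) and ℝᴱ is
-- Vector ℝ (size E).
record Matroid (E : GroundSet) : Set₁ where
  field
    IsBasis  : Pred (Subset (size E)) 0ℓ
    isBasis? : Decidable IsBasis
    nonempty : ∃ IsBasis
    exchange : ∀ {B₁ B₂} → IsBasis B₁ → IsBasis B₂ →
               ∀ {x} → x ∈ B₁ → x ∉ B₂ →
               ∃ λ y → y ∈ B₂ × y ∉ B₁ × IsBasis ((B₁ - x) ∪ ⁅ y ⁆)

subsets : ∀ n → List (Subset n)
subsets zero    = [] ∷ []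
subsets (suc n) =
  List.map (outside ∷_) (subsets n) ++ List.map (inside ∷_) (subsets n)

module _ {E : GroundSet} (M : Matroid E) where
  open Matroid M

  rk : Subset (size E) → ℕ
  rk S = max 0 (List.map (λ B → ∣ S ∩ B ∣) (filter isBasis? (subsets (size E))))

  rank : ℕ
  rank = rk ⊤

  IsFlat : Pred (Subset (size E)) 0ℓ
  IsFlat F = ∀ e → e ∉ F → rk F ℕ.< rk (F ∪ ⁅ e ⁆)

  isFlat? : Decidable IsFlat
  isFlat? F = Fin.all? λ e → ¬? (e ∈? F) →-dec (rk F ℕ.<? rk (F ∪ ⁅ e ⁆))

  IsFlatOfRank : ℕ → Pred (Subset (size E)) 0ℓ
  IsFlatOfRank i F = IsFlat F × rk F ≡ i

  isFlatOfRank? : ∀ i → Decidable (IsFlatOfRank i)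
  isFlatOfRank? i F = isFlat? F ×-dec (rk F ℕ.≟ i)

  whitneyNumber : ℕ → ℕ
  whitneyNumber i = length (filter (isFlatOfRank? i) (subsets (size E)))

-- The point ∑_{i ∈ S} eᵢ.
indicatorVector : Subset n → Vector ℝ n
indicatorVector S i = if does (i ∈? S) then 1ᵣ else 0ᵣ

basePolytope : ∀ {E} → Matroid E → Pred (Vector ℝ (size E)) 0ℓ
basePolytope M = conv {I = ∃ IsBasis} (indicatorVector ∘ proj₁)
  where open Matroid M

image : ∀ {m n} → Fin m ↔ Fin n → Subset m → Subset n
image σ S = Vec.tabulate (Vec.lookup S ∘ Inverse.from σ)

infix 4 _≅_

_≅_ : ∀ {E E′} → Matroid E → Matroid E′ → Set
_≅_ {E} {E′} M N =
  Σ[ σ ∈ (Fin (size E) ↔ Fin (size E′)) ]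
    (∀ B → Matroid.IsBasis M B ⇔ Matroid.IsBasis N (image σ B))

------------------------------------------------------------------------
-- Valuations

module _ (A : AbelianGroup c ℓ) where
  open AbelianGroup A
  open RawMonoidDefinitions rawMonoid using (sum) renaming (_×_ to _×ℕ_)

  infixr 8 _·_

  _·_ : ℤ → Carrier → Carrier
  (+ n)    · x = n ×ℕ x
  -[1+ n ] · x = (suc n ×ℕ x) ⁻¹

  IsValuation : (∀ E → Matroid E → Carrier) → Set (1ℓ ⊔ ℓ)
  IsValuation f =
    ∀ E s (M : Fin s → Matroid E) (k : Fin s → ℤ) →
    (∀ (x : Vector ℝ (size E)) (v : Fin s → ℤ) →
       (∀ i → Indicator (basePolytope (M i)) x (v i)) →
       ∑ℤ (λ i → k i ℤ.* v i) ≡ 0ℤ) →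
    sum (λ i → k i · f E (M i)) ≈ ε

  IsInvariant : (∀ E → Matroid E → Carrier) → Set (1ℓ ⊔ ℓ)
  IsInvariant f =
    ∀ {E E′} (M : Matroid E) (N : Matroid E′) → M ≅ N → f E M ≈ f E′ N

  IsValuativeInvariant : (∀ E → Matroid E → Carrier) → Set (1ℓ ⊔ ℓ)
  IsValuativeInvariant f = IsValuation f × IsInvariant f

------------------------------------------------------------------------
-- The additive group of ℤ[t], and Whitney polynomials

record Polynomial : Set where
  field
    coeff  : ℕ → ℤ
    finite : ∃ λ N → ∀ i → N ℕ.≤ i → coeff i ≡ 0ℤ

open Polynomial public

infix 4 _≈ₚ_

_≈ₚ_ : Polynomial → Polynomial → Set
p ≈ₚ q = ∀ i → coeff p i ≡ coeff q i

0ₚ : Polynomial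
coeff  0ₚ _ = 0ℤ
finite 0ₚ   = 0 , λ _ _ → refl

infixl 6 _+ₚ_

_+ₚ_ : Polynomial → Polynomial → Polynomial
coeff (p +ₚ q) i = coeff p i ℤ.+ coeff q i
finite (p +ₚ q) with finite p | finite q
... | N₁ , p≡0 | N₂ , q≡0 = N₁ ℕ.⊔ N₂ , λ i N≤i →
  cong₂ ℤ._+_ (p≡0 i (ℕ.m⊔n≤o⇒m≤o N₁ N₂ N≤i)) (q≡0 i (ℕ.m⊔n≤o⇒n≤o N₁ N₂ N≤i))

-ₚ_ : Polynomial → Polynomial
coeff (-ₚ p) i = ℤ.- coeff p i
finite (-ₚ p) with finite p
... | N , p≡0 = N , λ i N≤i → cong ℤ.-_ (p≡0 i N≤i)

ℤ[t] : AbelianGroup 0ℓ 0ℓ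
ℤ[t] = record
  { Carrier = Polynomial
  ; _≈_     = _≈ₚ_
  ; _∙_     = _+ₚ_
  ; ε       = 0ₚ
  ; _⁻¹     = -ₚ_
  ; isAbelianGroup = record
    { isGroup = record
      { isMonoid = record
        { isSemigroup = record
          { isMagma = record
            { isEquivalence = record
              { refl  = λ _ → refl
              ; sym   = λ p≈q i → sym (p≈q i)
              ; trans = λ p≈q q≈r i → trans (p≈q i) (q≈r i)
              }
            ; ∙-cong = λ p≈p′ q≈q′ i → cong₂ ℤ._+_ (p≈p′ i) (q≈q′ i)
            }
          ; assoc = λ p q r i → ℤ.+-assoc (coeff p i) (coeff q i) (coeff r i)
          }
        ; identity = (λ p i → ℤ.+-identityˡ (coeff p i))
                   , (λ p i → ℤ.+-identityʳ (coeff p i))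
        }
      ; inverse = (λ p i → ℤ.+-inverseˡ (coeff p i))
                , (λ p i → ℤ.+-inverseʳ (coeff p i))
      ; ⁻¹-cong = λ p≈q i → cong ℤ.-_ (p≈q i)
      }
    ; comm = λ p q i → ℤ.+-comm (coeff p i) (coeff q i)
    }
  }

open RawMonoidDefinitions (AbelianGroup.rawMonoid ℤ[t])
  using () renaming (sum to ∑ₚ)

infix 8 _t^_

_t^_ : ℤ → ℕ → Polynomial
coeff (c t^ i) j = if does (i ℕ.≟ j) then c else 0ℤ
finite (c t^ i) = suc i , λ j i<j →
  cong (if_then c else 0ℤ) (dec-false (i ℕ.≟ j) (ℕ.<⇒≢ i<j))

whitneyPolynomial : ∀ E → Matroid E → Polynomial
whitneyPolynomial E M =
  ∑ₚ {suc (rank M)} (λ i → (+ whitneyNumber M (toℕ i)) t^ toℕ i)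

{-# OPTIONS --safe #-}

-- Flats.  For F ⊆ E, the alternating sum of (-1)^|T \ F| over the sets T with
-- F ⊆ T ⊆ cl F is 1 if F is a flat and 0 otherwise.  The Whitney numbers are
-- therefore integer combinations of the functions [rk F ≥ i and rk T ≥ j] with
-- F ⊆ T, and it suffices that these are valuations.
--
-- Chains.  The rank of F is the maximum of x(F) = Σ_{e ∈ F} x_e over P(M), and
-- for F ⊆ T both maxima are attained at a common vertex.  So
-- [rk F ≥ i and rk T ≥ j] is the Euler characteristic of
-- P(M) ∩ {x(F) ≥ i, x(T) ≥ j}.  Eliminating one coordinate at a time, first
-- those outside T, then those in T \ F, then those in F, keeps every
-- projection a g-polymatroid, whose fibres over integral points have integral
-- endpoints.  A coordinate at depth k may thus be sampled on 2⁻ᵏ ℤ, and the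
-- Euler characteristic becomes a signed sum of values of the indicator
-- function at dyadic points, with signs that do not depend on M.
--
-- Membership of these points in P(M) is decided by Edmonds' inequalities; that
-- they suffice is an integer decomposition derived from Frank's discrete
-- sandwich theorem.
module Submission where

open import Algebra.Bundles using (AbelianGroup; CommutativeRing)
import Algebra.Definitions.RawMonoid as RawMonoidDefinitions
import Algebra.Properties.CommutativeMonoid.Sum as CommutativeMonoidSum
import Algebra.Properties.Semiring.Sum as SemiringSum
open import Data.Bool.Base using (Bool; true; false; _∧_; _∨_; not; if_then_else_)
open import Data.Fin.Base using (Fin; zero; suc; toℕ)
import Data.Fin.Properties as Fin
open import Data.Fin.Subset
  using (Subset; inside; outside; _∈_; _∉_; _⊆_; _∩_; _∪_; ∁; ⊤; ⊥; ∣_∣; ⁅_⁆; Nonempty)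
  renaming (_-_ to _∖_)
open import Data.Fin.Subset.Properties
open import Data.Integer.Base as ℤ
  using (ℤ; +_; -[1+_]; +≤+; +<+; -<+; 0ℤ; 1ℤ; -_; _+_; _-_; _*_; _⊔_; _≤_; _<_;
         +-0-rawMonoid)
open import Data.Integer.Properties hiding (_≟_)
open import Data.Integer.Tactic.RingSolver using (solve-∀)
open import Data.List.Base as List using (List; []; _∷_; length; filter)
open import Data.List.Extrema.Nat using (xs≤max; argmax-sel)
import Data.List.Membership.Propositional as List
import Data.List.Membership.Propositional.Properties as List
open import Data.List.Membership.Propositional.Properties.WithK using (unique∧set⇒bag)
import Data.List.Properties as List
open import Data.List.Relation.Binary.BagAndSetEquality using (∼bag⇒↭)
open import Data.List.Relation.Binary.Permutation.Propositional.Properties using (↭-length)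
import Data.List.Relation.Unary.All as All
import Data.List.Relation.Unary.AllPairs as AllPairs
import Data.List.Relation.Unary.Any as Any
open import Data.List.Relation.Unary.Unique.Propositional using (Unique)
import Data.List.Relation.Unary.Unique.Propositional.Properties as Unique
open import Data.Nat.Base as ℕ using (ℕ; zero; suc)
import Data.Nat.Coprimality as Coprimality
import Data.Nat.Properties as ℕ
open import Data.Product.Base using (∃; ∃₂; _×_; _,_; proj₁; proj₂)
open import Data.Rational.Base as ℚ using (ℚ; mkℚ; 0ℚ; 1ℚ; ½; *≤*)
import Data.Rational.Properties as ℚ
open import Data.Rational.Solver using (module +-*-Solver)
open import Data.Rational.Unnormalised.Base using (*≡*)
import Data.Rational.Unnormalised.Properties as ℚᵘ
open import Data.Sum.Base using (_⊎_; inj₁; inj₂)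
import Data.Unit.Base as Unit
open import Data.Vec.Base as Vec
  using (Vec; []; _∷_; here; there; insertAt; removeAt; lookup)
open import Data.Vec.Functional using (Vector)
import Data.Vec.Properties as Vec
open import Data.Vec.Properties using (insertAt-removeAt; lookup⇒[]=; []=⇒lookup)
open import Function.Base using (_∘_; id)
open import Function.Bundles using (_⇔_; mk⇔; Equivalence; _↔_; Inverse)
open import Function.Construct.Symmetry using (↔-sym)
open import Relation.Binary.PropositionalEquality
  using (_≡_; refl; sym; trans; cong; cong₂; subst; subst₂; module ≡-Reasoning)
open import Relation.Nullary
  using (¬_; Dec; yes; no; does; contradiction; ¬?; _×-dec_; _→-dec_)
open import Relation.Nullary.Decidable using (dec-true; dec-false; decidable-stable)
import Relation.Unary as U

open import Defs

-- The hypothesis supplies only values of indicator functions at single points, whereas a rank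
-- condition asserts that some point of a polytope exists. The Euler characteristic turns existence
-- into a signed count, being 1 on a nonempty compact convex set and 0 on the empty set. For an
-- interval with lattice endpoints it is the number of lattice points minus the number of unit
-- segments between them; an open segment is sampled at its midpoint. Lifting a point over one more
-- coordinate thus halves the lattice step, whence the powers of two, and since all coordinates lie
-- in [0, 1] one finite grid serves every matroid on the ground set.
--
-- The obstacle is that two simultaneous constraints could spoil the lattice endpoints or exclude
-- each other. For nested sets neither happens: each constraint bounds the sum of all coordinates
-- still present, which raises only the lower function of the g-polymatroid. The upper function
-- remains a restriction of the rank function, so the later constraint is tested against the rank of
-- F, unaffected by the earlier one.

private
  module ∑ℕ = CommutativeMonoidSum ℕ.+-0-commutativeMonoid
  module ∑ℤ = SemiringSum (CommutativeRing.semiring +-*-commutativeRing)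
  module ∑ℚ = SemiringSum (CommutativeRing.semiring ℚ.+-*-commutativeRing)

open ∑ℕ using () renaming (sum to ∑ℕ)
open ∑ℚ using () renaming (sum to ∑ℚ)
open RawMonoidDefinitions +-0-rawMonoid using () renaming (sum to ∑)
open RawMonoidDefinitions +ᵣ-rawMonoid using () renaming (sum to ∑ᵣ)
open RawMonoidDefinitions (AbelianGroup.rawMonoid ℤ[t])
  using () renaming (sum to ∑ₚ; _×_ to _×ₚ_)

-- Linear inequalities over the integers, and sums of coordinates

private variable
  k n : ℕ

-- Linear arithmetic by certificates: the slack of the goal equals the slack of the hypothesis, or
-- in the variants below a sum of slacks. The equation is typically an instance of a ring identity.
lin₁ : ∀ {a b c d : ℤ} → b - a ≡ d - c → c ≤ d → a ≤ b
lin₁ eq c≤d = 0≤i-j⇒j≤i (subst (0ℤ ≤_) (sym eq) (i≤j⇒0≤j-i c≤d))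

lin₂ : ∀ {a b c d c′ d′ : ℤ} →
       b - a ≡ (d - c) + (d′ - c′) → c ≤ d → c′ ≤ d′ → a ≤ b
lin₂ eq p q =
  0≤i-j⇒j≤i (subst (0ℤ ≤_) (sym eq) (+-mono-≤ (i≤j⇒0≤j-i p) (i≤j⇒0≤j-i q)))

lin₃ : ∀ {a b c d c′ d′ c″ d″ : ℤ} →
       b - a ≡ (d - c) + (d′ - c′) + (d″ - c″) →
       c ≤ d → c′ ≤ d′ → c″ ≤ d″ → a ≤ b
lin₃ eq p q r = 0≤i-j⇒j≤i (subst (0ℤ ≤_) (sym eq)
  (+-mono-≤ (+-mono-≤ (i≤j⇒0≤j-i p) (i≤j⇒0≤j-i q)) (i≤j⇒0≤j-i r)))

double : ℤ → ℤ
double a = a + a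

-- x(S), the sum of the coordinates of x indexed by S.
ev : Vec ℤ k → Subset k → ℤ
ev []       []            = 0ℤ
ev (x ∷ xs) (inside ∷ S)  = x + ev xs S
ev (x ∷ xs) (outside ∷ S) = ev xs S

ev-⊥ : (x : Vec ℤ k) → ev x ⊥ ≡ 0ℤ
ev-⊥ []       = refl
ev-⊥ (x ∷ xs) = ev-⊥ xs

ev-∪-∩ : (x : Vec ℤ k) (S T : Subset k) →
         ev x (S ∪ T) + ev x (S ∩ T) ≡ ev x S + ev x T
ev-∪-∩ []       []            []            = refl
ev-∪-∩ (a ∷ x) (outside ∷ S) (outside ∷ T) = ev-∪-∩ x S T
ev-∪-∩ (a ∷ x) (outside ∷ S) (inside ∷ T)
  = trans (+-assoc a _ _) (trans (cong (_+_ a) (ev-∪-∩ x S T)) (lemma a (ev x S) (ev x T)))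
  where
  lemma : ∀ a s t → a + (s + t) ≡ s + (a + t)
  lemma = solve-∀
ev-∪-∩ (a ∷ x) (inside ∷ S)  (outside ∷ T)
  = trans (+-assoc a _ _) (trans (cong (_+_ a) (ev-∪-∩ x S T)) (sym (+-assoc a _ _)))
ev-∪-∩ (a ∷ x) (inside ∷ S)  (inside ∷ T)
  = trans (lemma₁ a _ _) (trans (cong (λ s → a + a + s) (ev-∪-∩ x S T)) (lemma₂ a _ _))
  where
  lemma₁ : ∀ a s t → (a + s) + (a + t) ≡ a + a + (s + t)
  lemma₁ = solve-∀
  lemma₂ : ∀ a s t → a + a + (s + t) ≡ (a + s) + (a + t)
  lemma₂ = solve-∀

ev-∁ : (x : Vec ℤ k) (S : Subset k) → ev x S + ev x (∁ S) ≡ ev x ⊤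
ev-∁ []      []            = refl
ev-∁ (a ∷ x) (outside ∷ S) = trans (lemma a (ev x S) (ev x (∁ S))) (cong (_+_ a) (ev-∁ x S))
  where
  lemma : ∀ a s t → s + (a + t) ≡ a + (s + t)
  lemma = solve-∀
ev-∁ (a ∷ x) (inside ∷ S)  = trans (+-assoc a _ _) (cong (_+_ a) (ev-∁ x S))

-- Both sides are x(S ∪ T).
ev-differences : (x : Vec ℤ k) (S T : Subset k) →
                 ev x S + ev x (T ∩ ∁ S) ≡ ev x T + ev x (S ∩ ∁ T)
ev-differences []      []            []            = refl
ev-differences (a ∷ x) (outside ∷ S) (outside ∷ T) = ev-differences x S T
ev-differences (a ∷ x) (outside ∷ S) (inside ∷ T)
  = trans (lemma a (ev x S) (ev x (T ∩ ∁ S)))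
    (trans (cong (_+_ a) (ev-differences x S T)) (sym (+-assoc a _ _)))
  where
  lemma : ∀ a s t → s + (a + t) ≡ a + (s + t)
  lemma = solve-∀
ev-differences (a ∷ x) (inside ∷ S)  (outside ∷ T)
  = trans (+-assoc a _ _) (trans (cong (_+_ a) (ev-differences x S T))
    (lemma a (ev x T) (ev x (S ∩ ∁ T))))
  where
  lemma : ∀ a s t → a + (s + t) ≡ s + (a + t)
  lemma = solve-∀
ev-differences (a ∷ x) (inside ∷ S)  (inside ∷ T)
  = trans (+-assoc a _ _) (trans (cong (_+_ a) (ev-differences x S T)) (sym (+-assoc a _ _)))

ev-double : (x : Vec ℤ k) (S : Subset k) → ev (Vec.map double x) S ≡ double (ev x S)
ev-double []      []            = refl
ev-double (a ∷ x) (outside ∷ S) = ev-double x S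
ev-double (a ∷ x) (inside ∷ S)  =
  trans (cong (λ s → a + a + s) (ev-double x S)) (lemma a (ev x S))
  where
  lemma : ∀ a s → a + a + (s + s) ≡ (a + s) + (a + s)
  lemma = solve-∀

ev-insertAt-inside : (x : Vec ℤ k) (S : Subset k) (e : Fin (suc k)) (a : ℤ) →
  ev (insertAt x e a) (insertAt S e inside) ≡ a + ev x S
ev-insertAt-inside x       S             zero    a = refl
ev-insertAt-inside (y ∷ x) (outside ∷ S) (suc e) a = ev-insertAt-inside x S e a
ev-insertAt-inside (y ∷ x) (inside ∷ S)  (suc e) a =
  trans (cong (_+_ y) (ev-insertAt-inside x S e a)) (lemma y a (ev x S))
  where
  lemma : ∀ y a s → y + (a + s) ≡ a + (y + s)
  lemma = solve-∀

ev-insertAt-outside : (x : Vec ℤ k) (S : Subset k) (e : Fin (suc k)) (a : ℤ) →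
  ev (insertAt x e a) (insertAt S e outside) ≡ ev x S
ev-insertAt-outside x       S             zero    a = refl
ev-insertAt-outside (y ∷ x) (outside ∷ S) (suc e) a = ev-insertAt-outside x S e a
ev-insertAt-outside (y ∷ x) (inside ∷ S)  (suc e) a =
  cong (_+_ y) (ev-insertAt-outside x S e a)

indicator : Subset k → Vec ℤ k
indicator = Vec.map (λ s → if s then 1ℤ else 0ℤ)

ev-indicator : (B S : Subset k) → ev (indicator B) S ≡ + ∣ S ∩ B ∣
ev-indicator []            []            = refl
ev-indicator (b ∷ B)       (outside ∷ S) = ev-indicator B S
ev-indicator (outside ∷ B) (inside ∷ S)  = trans (+-identityˡ _) (ev-indicator B S)
ev-indicator (inside ∷ B)  (inside ∷ S)  = cong (_+_ 1ℤ) (ev-indicator B S)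

-- The discrete sandwich theorem

max⊆ : (Subset k → ℤ) → ℤ
max⊆ {zero}  f = f []
max⊆ {suc k} f = max⊆ (f ∘ (outside ∷_)) ⊔ max⊆ (f ∘ (inside ∷_))

≤max⊆ : (f : Subset k → ℤ) (S : Subset k) → f S ≤ max⊆ f
≤max⊆ f []            = ≤-refl
≤max⊆ f (outside ∷ S) = i≤j⇒i≤j⊔k _ (≤max⊆ (f ∘ (outside ∷_)) S)
≤max⊆ f (inside ∷ S)  = i≤j⇒i≤k⊔j _ (≤max⊆ (f ∘ (inside ∷_)) S)

max⊆-attained : (f : Subset k → ℤ) → ∃ λ S → max⊆ f ≡ f S
max⊆-attained {zero}  f = [] , refl
max⊆-attained {suc k} f
  with ⊔-sel (max⊆ (f ∘ (outside ∷_))) (max⊆ (f ∘ (inside ∷_)))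
... | inj₁ eq with S , eq′ ← max⊆-attained (f ∘ (outside ∷_)) =
  outside ∷ S , trans eq eq′
... | inj₂ eq with S , eq′ ← max⊆-attained (f ∘ (inside ∷_)) =
  inside ∷ S , trans eq eq′

Supermodular : (Subset k → ℤ) → Set
Supermodular p = ∀ X Y → p X + p Y ≤ p (X ∪ Y) + p (X ∩ Y)

-- The constraints that p imposes on the remaining coordinates once the first
-- one has been given the value c.
fix : ℤ → (Subset (suc k) → ℤ) → Subset k → ℤ
fix c p S = p (outside ∷ S) ⊔ (p (inside ∷ S) - c)

module _ (c : ℤ) (p : Subset (suc k) → ℤ) where

  private
    branch : Bool → Subset k → ℤ
    branch s S = p (s ∷ S) - (if s then c else 0ℤ)

    branch-sel : ∀ S → ∃ λ s → fix c p S ≡ branch s S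
    branch-sel S with ⊔-sel (p (outside ∷ S)) (p (inside ∷ S) - c)
    ... | inj₁ eq = outside , trans eq (sym (+-identityʳ _))
    ... | inj₂ eq = inside  , eq

    branch≤ : ∀ s S → branch s S ≤ fix c p S
    branch≤ outside S = ≤-trans (≤-reflexive (+-identityʳ _)) (i≤i⊔j _ _)
    branch≤ inside  S = i≤j⊔i _ _

    weights : ∀ s t → (if s ∨ t then c else 0ℤ) + (if s ∧ t then c else 0ℤ)
              ≡ (if s then c else 0ℤ) + (if t then c else 0ℤ)
    weights outside t       = +-comm (if t then c else 0ℤ) 0ℤ
    weights inside  outside = refl
    weights inside  inside  = refl

  fix-outside : ∀ S → p (outside ∷ S) ≤ fix c p S
  fix-outside S = i≤i⊔j _ _

  fix-inside : ∀ S → p (inside ∷ S) ≤ fix c p S + c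
  fix-inside S = lin₁ (lemma (p (inside ∷ S)) (fix c p S) c)
    (i≤j⊔i (p (outside ∷ S)) (p (inside ∷ S) - c))
    where
    lemma : ∀ x y c → y + c - x ≡ y - (x - c)
    lemma = solve-∀

  -- Each maximum is attained with the first element either in or out. Union and intersection act on
  -- these choices as `∨` and `∧`, and the weight c of the first element is modular, so
  -- supermodularity of `p` one dimension higher applies.
  fix-supermodular : Supermodular p → Supermodular (fix c p)
  fix-supermodular super X Y with branch-sel X | branch-sel Y
  ... | s , eq₁ | t , eq₂ = begin
    fix c p X + fix c p Y                          ≡⟨ cong₂ _+_ eq₁ eq₂ ⟩
    branch s X + branch t Y                        ≤⟨ lin₁ step (super (s ∷ X) (t ∷ Y)) ⟩
    branch (s ∨ t) (X ∪ Y) + branch (s ∧ t) (X ∩ Y)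
      ≤⟨ +-mono-≤ (branch≤ (s ∨ t) (X ∪ Y)) (branch≤ (s ∧ t) (X ∩ Y)) ⟩
    fix c p (X ∪ Y) + fix c p (X ∩ Y)              ∎
    where
    open ≤-Reasoning
    lemma : ∀ x y u i a b c d → c + d ≡ a + b →
            (u - c) + (i - d) - ((x - a) + (y - b)) ≡ u + i - (x + y)
    lemma x y u i a b c d eq = trans (l₁ x y u i a b c d)
      (trans (cong (λ z → u + i - (x + y) + (a + b - z)) eq) (l₂ x y u i a b))
      where
      l₁ : ∀ x y u i a b c d → (u - c) + (i - d) - ((x - a) + (y - b))
           ≡ u + i - (x + y) + (a + b - (c + d))
      l₁ = solve-∀
      l₂ : ∀ x y u i a b → u + i - (x + y) + (a + b - (a + b)) ≡ u + i - (x + y)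
      l₂ = solve-∀
    step : branch (s ∨ t) (X ∪ Y) + branch (s ∧ t) (X ∩ Y) - (branch s X + branch t Y)
           ≡ p ((s ∨ t) ∷ (X ∪ Y)) + p ((s ∧ t) ∷ (X ∩ Y)) - (p (s ∷ X) + p (t ∷ Y))
    step = lemma (p (s ∷ X)) (p (t ∷ Y)) (p ((s ∨ t) ∷ (X ∪ Y))) (p ((s ∧ t) ∷ (X ∩ Y)))
                 (if s then c else 0ℤ) (if t then c else 0ℤ)
                 (if s ∨ t then c else 0ℤ) (if s ∧ t then c else 0ℤ) (weights s t)

-- When both maxima choose the same side, the terms in c cancel. The two mixed choices are what
-- confines c from below and from above.
fix-antagonistic : ∀ (p q : Subset (suc k) → ℤ) c →
  (∀ S → p S + q S ≤ 0ℤ) →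
  (∀ S → p (inside ∷ S) + q (outside ∷ S) ≤ c) →
  (∀ S → p (outside ∷ S) + q (inside ∷ S) ≤ - c) →
  ∀ S → fix c p S + fix (- c) q S ≤ 0ℤ
fix-antagonistic p q c p+q≤0 lower upper S
  with ⊔-sel (p (outside ∷ S)) (p (inside ∷ S) - c)
     | ⊔-sel (q (outside ∷ S)) (q (inside ∷ S) - - c)
... | inj₁ eq | inj₁ eq′ rewrite eq | eq′ = p+q≤0 (outside ∷ S)
... | inj₁ eq | inj₂ eq′ rewrite eq | eq′ = lin₁ (l (p (outside ∷ S)) (q (inside ∷ S)) c) (upper S)
  where
  l : ∀ x y c → 0ℤ - (x + (y - - c)) ≡ - c - (x + y)
  l = solve-∀
... | inj₂ eq | inj₁ eq′ rewrite eq | eq′ = lin₁ (l (p (inside ∷ S)) (q (outside ∷ S)) c) (lower S)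
  where
  l : ∀ x y c → 0ℤ - (x - c + y) ≡ c - (x + y)
  l = solve-∀
... | inj₂ eq | inj₂ eq′ rewrite eq | eq′ =
  lin₁ (l (p (inside ∷ S)) (q (inside ∷ S)) c) (p+q≤0 (inside ∷ S))
  where
  l : ∀ x y c → 0ℤ - ((x - c) + (y - - c)) ≡ 0ℤ - (x + y)
  l = solve-∀

-- Frank's discrete sandwich theorem for p ≤ -q.
sandwich : (p q : Subset k → ℤ) → Supermodular p → Supermodular q →
           (∀ S → p S + q S ≤ 0ℤ) →
           ∃₂ λ (d : ℤ) (m : Vec ℤ k) →
             ∀ S → p S ≤ d + ev m S × q S ≤ - (d + ev m S)
sandwich {zero} p q _ _ p+q≤0 = p [] , [] , λ where
    [] → ≤-reflexive (sym (+-identityʳ (p []))) ,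
         lin₁ (l (p []) (q [])) (p+q≤0 [])
  where
  l : ∀ x y → - (x + 0ℤ) - y ≡ 0ℤ - (x + y)
  l = solve-∀
sandwich {suc k} p q p-super q-super p+q≤0 = d , c ∷ m , λ where
    (outside ∷ S) → ≤-trans (fix-outside c p S) (proj₁ (bounds S)) ,
                    ≤-trans (fix-outside (- c) q S) (proj₂ (bounds S))
    (inside ∷ S)  →
      lin₂ (l₁ (p (inside ∷ S)) (fix c p S) c d (ev m S))
        (fix-inside c p S) (proj₁ (bounds S)) ,
      lin₂ (l₂ (q (inside ∷ S)) (fix (- c) q S) c d (ev m S))
        (fix-inside (- c) q S) (proj₂ (bounds S))
  where
  -- The mixed choices require c to dominate every `gap` and to stay below the bounds in `upper`.
  -- The least candidate is taken; as a maximum of integers it is an integer, which is the discrete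
  -- part of the theorem.
  gap : Subset k → ℤ
  gap S = p (inside ∷ S) + q (outside ∷ S)
  c : ℤ
  c = max⊆ gap
  lower : ∀ S → gap S ≤ c
  lower = ≤max⊆ gap
  -- The admissible range for c is nonempty: supermodularity of `p` and of `q` trades the mixed
  -- pairs for pairs with equal arguments, S ∪ T with the first element and S ∩ T without it, where
  -- p + q ≤ 0.
  crossing : ∀ S T → gap S + (p (outside ∷ T) + q (inside ∷ T)) ≤ 0ℤ
  crossing S T = lin₃ (l (p (inside ∷ S)) (q (outside ∷ S)) (p (outside ∷ T)) (q (inside ∷ T))
                         (p (inside ∷ (S ∪ T))) (q (inside ∷ (S ∪ T)))
                         (p (outside ∷ (S ∩ T))) (q (outside ∷ (S ∩ T))))
    (+-mono-≤ (p-super (inside ∷ S) (outside ∷ T)) (q-super (outside ∷ S) (inside ∷ T)))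
    (p+q≤0 (inside ∷ (S ∪ T))) (p+q≤0 (outside ∷ (S ∩ T)))
    where
    l : ∀ a b c d u v w x →
        0ℤ - (a + b + (c + d)) ≡
        (u + w + (v + x)) - (a + c + (b + d)) + (0ℤ - (u + v)) + (0ℤ - (w + x))
    l = solve-∀
  upper : ∀ T → p (outside ∷ T) + q (inside ∷ T) ≤ - c
  upper T = subst (_≤ - c) (neg-involutive (p (outside ∷ T) + q (inside ∷ T)))
    (neg-mono-≤ (subst (_≤ - (p (outside ∷ T) + q (inside ∷ T))) (sym attained)
      (lin₁ (l (gap S) (p (outside ∷ T) + q (inside ∷ T))) (crossing S T))))
    where
    S : Subset k
    S = proj₁ (max⊆-attained gap)
    attained : c ≡ gap S
    attained = proj₂ (max⊆-attained gap)
    l : ∀ g x → - x - g ≡ 0ℤ - (g + x)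
    l = solve-∀
  rest : ∃₂ λ d m → ∀ S → fix c p S ≤ d + ev m S × fix (- c) q S ≤ - (d + ev m S)
  rest = sandwich (fix c p) (fix (- c) q)
    (fix-supermodular c p p-super) (fix-supermodular (- c) q q-super)
    (fix-antagonistic p q c p+q≤0 lower upper)
  d : ℤ
  d = proj₁ rest
  m : Vec ℤ k
  m = proj₁ (proj₂ rest)
  bounds : ∀ S → fix c p S ≤ d + ev m S × fix (- c) q S ≤ - (d + ev m S)
  bounds = proj₂ (proj₂ rest)
  l₁ : ∀ x f c d e → d + (c + e) - x ≡ (f + c - x) + (d + e - f)
  l₁ = solve-∀
  l₂ : ∀ x f c d e → - (d + (c + e)) - x ≡ (f + - c - x) + (- (d + e) - f)
  l₂ = solve-∀

<-≤-connex : ∀ a b → a < b ⊎ b ≤ a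
<-≤-connex a b with a <? b
... | yes a<b = inj₁ a<b
... | no  a≮b = inj₂ (≮⇒≥ a≮b)

-- Euler characteristics over dyadic grids

double-mono-≤ : ∀ {a b} → a ≤ b → double a ≤ double b
double-mono-≤ a≤b = +-mono-≤ a≤b a≤b

double-cancel-≤ : ∀ {a b} → double a ≤ double b → a ≤ b
double-cancel-≤ {a} {b} 2a≤2b with <-≤-connex b a
... | inj₁ b<a = contradiction 2a≤2b (<⇒≱ (+-mono-< b<a b<a))
... | inj₂ a≤b = a≤b

double-* : ∀ a b → double a * b ≡ double (a * b)
double-* a b = *-distribʳ-+ b a a

i-1<i : ∀ i → i - 1ℤ < i
i-1<i i = subst (i - 1ℤ <_) (+-identityʳ i) (+-monoʳ-< i -<+)

-- Σ_{a=0}^{2m} (-1)ᵃ g(a)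
alternating : ℕ → (ℤ → ℤ) → ℤ
alternating zero    g = g 0ℤ
alternating (suc m) g =
  alternating m g + (g (double (+ suc m)) - g (double (+ suc m) - 1ℤ))

-- The Euler characteristic of a closed interval, obtained by counting its
-- even (closed points) minus its odd (open segments) elements.
module _ (g : ℤ → ℤ) {lo hi : ℤ} (0≤lo : 0ℤ ≤ lo) (lo≤hi : lo ≤ hi)
         (g-in  : ∀ a → double lo ≤ a → a ≤ double hi → g a ≡ 1ℤ)
         (g-out : ∀ a → a < double lo ⊎ double hi < a → g a ≡ 0ℤ) where

  private
    alternating-below : ∀ m → + m < lo → alternating m g ≡ 0ℤ
    alternating-below zero    0<lo = g-out 0ℤ (inj₁ (+-mono-< 0<lo 0<lo))
    alternating-below (suc m) m<lo
      rewrite alternating-below m (<-trans (+<+ (ℕ.s≤s ℕ.≤-refl)) m<lo)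
            | g-out (double (+ suc m)) (inj₁ (+-mono-< m<lo m<lo))
            | g-out (double (+ suc m) - 1ℤ)
                (inj₁ (<-trans (i-1<i (double (+ suc m))) (+-mono-< m<lo m<lo)))
            = refl

    double-m< : ∀ m → double (+ m) < double (+ suc m) - 1ℤ
    double-m< m = subst₂ _<_ (+-identityʳ (double (+ m))) (eq (+ m))
                    (+-monoʳ-< (double (+ m)) (+<+ (ℕ.s≤s ℕ.z≤n)))
      where
      eq : ∀ x → x + x + 1ℤ ≡ (1ℤ + x) + (1ℤ + x) - 1ℤ
      eq = solve-∀

    -- Both endpoints are even. After the first point of the interval, each segment 2m + 1 and its
    -- right end 2m + 2 are therefore both inside or both outside, and the pair contributes nothing.
    alternating-above : ∀ m → lo ≤ + m → alternating m g ≡ 1ℤ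
    alternating-above zero    lo≤0 = g-in 0ℤ (double-mono-≤ lo≤0)
                                       (double-mono-≤ (≤-trans 0≤lo lo≤hi))
    alternating-above (suc m) lo≤m with <-≤-connex (+ m) lo
    ... | inj₁ m<lo
      rewrite alternating-below m m<lo
            | g-in (double (+ suc m)) (double-mono-≤ lo≤m)
                (double-mono-≤ (≤-trans (i<j⇒suc[i]≤j m<lo) lo≤hi))
            | g-out (double (+ suc m) - 1ℤ) (inj₁ (<-≤-trans (i-1<i (double (+ suc m)))
                (double-mono-≤ (i<j⇒suc[i]≤j m<lo))))
            = refl
    ... | inj₂ lo≤m with <-≤-connex hi (+ suc m)
    ...   | inj₁ hi<m
      rewrite alternating-above m lo≤m
            | g-out (double (+ suc m)) (inj₂ (+-mono-< hi<m hi<m))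
            | g-out (double (+ suc m) - 1ℤ)
                (inj₂ (≤-<-trans (double-mono-≤ (i<j⇒i≤pred[j] hi<m)) (double-m< m)))
            = refl
    ...   | inj₂ m≤hi
      rewrite alternating-above m lo≤m
            | g-in (double (+ suc m)) (double-mono-≤ (≤-trans lo≤m (+≤+ (ℕ.n≤1+n m))))
                (double-mono-≤ m≤hi)
            | g-in (double (+ suc m) - 1ℤ)
                (≤-trans (double-mono-≤ lo≤m) (<⇒≤ (double-m< m)))
                (≤-trans (<⇒≤ (i-1<i (double (+ suc m)))) (double-mono-≤ m≤hi))
            = refl

  alternating-interval : ∀ m → hi ≤ + m → alternating m g ≡ 1ℤ
  alternating-interval m hi≤m = alternating-above m (≤-trans lo≤hi hi≤m)

-- A schedule for eliminating the coordinates one at a time.  The entry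
-- guard α demands that the coordinates left at that moment sum to at least α.
data Plan : ℕ → Set where
  []    : Plan zero
  step  : Fin (suc k) → Plan k → Plan (suc k)
  guard : ℤ → Plan k → Plan k

2^_ : ℕ → ℕ
2^ zero  = 1
2^ suc k = 2^ k ℕ.+ 2^ k

eliminate : Fin (suc k) → (Vec ℤ (suc k) → ℤ) → Vec ℤ k → ℤ
eliminate {k} e f y = alternating (2^ k) λ a → f (insertAt (Vec.map double y) e a)

restrictTo : ℤ → (Vec ℤ k → ℤ) → Vec ℤ k → ℤ
restrictTo {k} α f y = if does (+ (2^ k) * α ≤? ev y ⊤) then f y else 0ℤ

-- The Euler characteristic, as a signed sum over a dyadic grid: the
-- coordinate eliminated from the last k + 1 ones runs through the multiples of
-- 2^-(k+1), and the points with an odd numerator count negatively.  The vector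
-- y : Vec ℤ k stands for the point y / 2^k.
χ : Plan k → (Vec ℤ k → ℤ) → ℤ
χ []          f = f []
χ (step e π)  f = χ π (eliminate e f)
χ (guard α π) f = χ π (restrictTo α f)

-- Only the upper function is consulted: a guard alters the lower one alone, and an elimination
-- restricts both to the remaining coordinates.
Admits : Plan k → (Subset k → ℤ) → Set
Admits []          b = Unit.⊤
Admits (step e π)  b = Admits π (λ S → b (insertAt S e outside))
Admits (guard α π) b = α ≤ b ⊤ × Admits π b

-- χ stays in any additive group of families of integers.
module Linearity {I : Set} (V : (I → ℤ) → Set) (V-0 : V λ _ → 0ℤ)
  (V-+ : ∀ {f g} → V f → V g → V λ i → f i + g i)
  (V-- : ∀ {f g} → V f → V g → V λ i → f i - g i) where

  V-alternating : ∀ m {g : I → ℤ → ℤ} → (∀ a → V λ i → g i a) →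
                  V λ i → alternating m (g i)
  V-alternating zero    Vg = Vg 0ℤ
  V-alternating (suc m) Vg = V-+ (V-alternating m Vg) (V-- (Vg _) (Vg _))

  V-restrictTo : ∀ α {f : I → Vec ℤ k → ℤ} → (∀ x → V λ i → f i x) →
                 ∀ x → V λ i → restrictTo α (f i) x
  V-restrictTo {k} α Vf x with does (+ (2^ k) * α ≤? ev x ⊤)
  ... | true  = Vf x
  ... | false = V-0

  V-χ : ∀ (π : Plan k) {f : I → Vec ℤ k → ℤ} →
        (∀ x → V λ i → f i x) → V λ i → χ π (f i)
  V-χ []          Vf = Vf []
  V-χ (step {k} e π)  Vf = V-χ π λ y → V-alternating (2^ k) λ a →
    Vf (insertAt (Vec.map double y) e a)
  V-χ (guard α π) Vf = V-χ π (V-restrictTo α Vf)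

-- The trivial group over a one-point index set: signed sums of the zero function are zero. This
-- handles empty fibres and guards that cannot be met.
module Vanishing = Linearity {I = Unit.⊤} (λ f → f _ ≡ 0ℤ) refl
  (cong₂ _+_) (cong₂ _-_)

-- Generalised polymatroids: projection and truncation

Indicates : {A : Set} → (A → ℤ) → (A → Set) → Set
Indicates f P = (∀ x → P x → f x ≡ 1ℤ) × (∀ x → ¬ P x → f x ≡ 0ℤ)

-- The g-polymatroids of Frank, in an axiomatisation closed under eliminating
-- a coordinate and under bounding the sum of all coordinates from below.
record Paramodular (p b : Subset k → ℤ) : Set where
  field
    p-⊥      : p ⊥ ≤ 0ℤ
    p-nonneg : ∀ S → 0ℤ ≤ p S
    b-⊥      : b ⊥ ≡ 0ℤ
    b-card   : ∀ S → b S ≤ + ∣ S ∣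
    b-sub    : ∀ X Y → b (X ∪ Y) + b (X ∩ Y) ≤ b X + b Y
    cross    : ∀ X Y → b (X ∩ ∁ Y) + p Y ≤ b X + p (Y ∩ ∁ X)

-- The integer points of the N-fold dilate of the g-polymatroid of `p` and `b`, so that points with
-- denominator N need no fractions.
InPolytope : ℕ → (p b : Subset k → ℤ) → Vec ℤ k → Set
InPolytope N p b x = ∀ S → + N * p S ≤ ev x S × ev x S ≤ + N * b S

insertAt-∪ : ∀ (X Y : Subset k) e s t →
             insertAt X e s ∪ insertAt Y e t ≡ insertAt (X ∪ Y) e (s ∨ t)
insertAt-∪ X       Y       zero    s t = refl
insertAt-∪ (x ∷ X) (y ∷ Y) (suc e) s t = cong (_ ∷_) (insertAt-∪ X Y e s t)

insertAt-∩ : ∀ (X Y : Subset k) e s t →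
             insertAt X e s ∩ insertAt Y e t ≡ insertAt (X ∩ Y) e (s ∧ t)
insertAt-∩ X       Y       zero    s t = refl
insertAt-∩ (x ∷ X) (y ∷ Y) (suc e) s t = cong (_ ∷_) (insertAt-∩ X Y e s t)

insertAt-∩∁ : ∀ (X Y : Subset k) e s t →
              insertAt X e s ∩ ∁ (insertAt Y e t) ≡ insertAt (X ∩ ∁ Y) e (s ∧ not t)
insertAt-∩∁ X       Y       zero    s t = refl
insertAt-∩∁ (x ∷ X) (y ∷ Y) (suc e) s t = cong (_ ∷_) (insertAt-∩∁ X Y e s t)

insertAt-⊥ : ∀ (e : Fin (suc k)) → insertAt ⊥ e outside ≡ ⊥
insertAt-⊥         zero    = refl
insertAt-⊥ {suc k} (suc e) = cong (outside ∷_) (insertAt-⊥ e)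

∣insertAt-outside∣ : ∀ (S : Subset k) e → ∣ insertAt S e outside ∣ ≡ ∣ S ∣
∣insertAt-outside∣ S             zero    = refl
∣insertAt-outside∣ (outside ∷ S) (suc e) = ∣insertAt-outside∣ S e
∣insertAt-outside∣ (inside ∷ S)  (suc e) = cong suc (∣insertAt-outside∣ S e)

∣insertAt-inside∣ : ∀ (S : Subset k) e → ∣ insertAt S e inside ∣ ≡ suc ∣ S ∣
∣insertAt-inside∣ S             zero    = refl
∣insertAt-inside∣ (outside ∷ S) (suc e) = ∣insertAt-inside∣ S e
∣insertAt-inside∣ (inside ∷ S)  (suc e) = cong suc (∣insertAt-inside∣ S e)

module _ {p b : Subset (suc k) → ℤ} (pb : Paramodular p b) (e : Fin (suc k)) where
  open Paramodular pb

  private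
    without within : Subset k → Subset (suc k)
    without S = insertAt S e outside
    within S   = insertAt S e inside

  delete-paramodular : Paramodular (p ∘ without) (b ∘ without)
  delete-paramodular = record
    { p-⊥      = subst (λ S → p S ≤ 0ℤ) (sym (insertAt-⊥ e)) p-⊥
    ; p-nonneg = p-nonneg ∘ without
    ; b-⊥      = trans (cong b (insertAt-⊥ e)) b-⊥
    ; b-card   = λ S → subst (λ c → b (without S) ≤ + c)
                   (∣insertAt-outside∣ S e) (b-card (without S))
    ; b-sub    = λ X Y → subst₂ (λ U I → b U + b I ≤ b (without X) + b (without Y))
                   (insertAt-∪ X Y e outside outside) (insertAt-∩ X Y e outside outside)
                   (b-sub (without X) (without Y))
    ; cross    = λ X Y → subst₂ (λ U I → b U + p (without Y) ≤ b (without X) + p I)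
                   (insertAt-∩∁ X Y e outside outside) (insertAt-∩∁ Y X e outside outside)
                   (cross (without X) (without Y))
    }

  module _ (f : Vec ℤ (suc k) → ℤ) (f-ind : Indicates f (InPolytope (2^ suc k) p b)) where

    private
      N : ℤ
      N = + (2^ k)

      extend : Vec ℤ k → ℤ → Vec ℤ (suc k)
      extend y a = insertAt (Vec.map double y) e a

      ev-without : ∀ y a S → ev (extend y a) (without S) ≡ double (ev y S)
      ev-without y a S = trans (ev-insertAt-outside (Vec.map double y) S e a) (ev-double y S)

      ev-with : ∀ y a S → ev (extend y a) (within S) ≡ a + double (ev y S)
      ev-with y a S = trans (ev-insertAt-inside (Vec.map double y) S e a)
                            (cong (_+_ a) (ev-double y S))

      -- The constraints of the sets containing e, solved for the new coordinate in the units of y.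
      -- They are integers, so the endpoints of the fibre become even once y is doubled. The sign of
      -- `upper` is reversed so that a maximum yields both endpoints.
      lower upper : Vec ℤ k → Subset k → ℤ
      lower y S = N * p (within S) - ev y S
      upper y S = ev y S - N * b (within S)

      lo hi : Vec ℤ k → ℤ
      lo y = max⊆ (lower y)
      hi y = - max⊆ (upper y)

      hi≤ : ∀ y S → hi y ≤ - upper y S
      hi≤ y S = neg-mono-≤ (≤max⊆ (upper y) S)

      hi-attained : ∀ y → ∃ λ S → hi y ≡ - upper y S
      hi-attained y = let S , eq = max⊆-attained (upper y) in S , cong -_ eq

      Below : Vec ℤ k → Set
      Below = InPolytope (2^ k) (p ∘ without) (b ∘ without)

      Above : Vec ℤ (suc k) → Set
      Above = InPolytope (2^ suc k) p b

      above⇒below : ∀ {y a} → Above (extend y a) → Below y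
      above⇒below {y} {a} above S =
        double-cancel-≤ (subst₂ _≤_ (double-* N _) (ev-without y a S) (proj₁ (above (without S)))) ,
        double-cancel-≤ (subst₂ _≤_ (ev-without y a S) (double-* N _) (proj₂ (above (without S))))

      double-lower : ∀ a s n → a + double s - double n ≡ a - double (n - s)
      double-lower = expand
        where
        expand : ∀ a s n → a + (s + s) - (n + n) ≡ a - ((n - s) + (n - s))
        expand = solve-∀

      double-upper : ∀ a s n → double n - (a + double s) ≡ double (- (s - n)) - a
      double-upper = expand
        where
        expand : ∀ a s n → n + n - (a + (s + s)) ≡ - (s - n) + - (s - n) - a
        expand = solve-∀

      above⇒lo≤ : ∀ {y a} → Above (extend y a) → double (lo y) ≤ a
      above⇒lo≤ {y} {a} above with S , eq ← max⊆-attained (lower y) =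
        subst (λ l → double l ≤ a) (sym eq)
          (lin₁ (sym (double-lower a (ev y S) (N * p (within S))))
            (subst₂ _≤_ (double-* N _) (ev-with y a S) (proj₁ (above (within S)))))

      above⇒≤hi : ∀ {y a} → Above (extend y a) → a ≤ double (hi y)
      above⇒≤hi {y} {a} above with S , eq ← hi-attained y =
        subst (λ h → a ≤ double h) (sym eq)
          (lin₁ (sym (double-upper a (ev y S) (N * b (within S))))
            (subst₂ _≤_ (ev-with y a S) (double-* N _) (proj₂ (above (within S)))))

      below⇒above : ∀ {y a} → Below y → double (lo y) ≤ a → a ≤ double (hi y) →
                    Above (extend y a)
      below⇒above {y} {a} below lo≤a a≤hi S =
        subst (λ S → double N * p S ≤ ev (extend y a) S × ev (extend y a) S ≤ double N * b S)
          (insertAt-removeAt S e) (bounds (removeAt S e) (lookup S e))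
        where
        bounds : ∀ S s → double N * p (insertAt S e s) ≤ ev (extend y a) (insertAt S e s) ×
                         ev (extend y a) (insertAt S e s) ≤ double N * b (insertAt S e s)
        bounds S outside =
          subst₂ _≤_ (sym (double-* N _)) (sym (ev-without y a S))
            (double-mono-≤ (proj₁ (below S))) ,
          subst₂ _≤_ (sym (ev-without y a S)) (sym (double-* N _))
            (double-mono-≤ (proj₂ (below S)))
        bounds S inside =
          subst₂ _≤_ (sym (double-* N _)) (sym (ev-with y a S))
            (lin₁ (double-lower a (ev y S) (N * p (within S)))
              (≤-trans (double-mono-≤ (≤max⊆ (lower y) S)) lo≤a)) ,
          subst₂ _≤_ (sym (ev-with y a S)) (sym (double-* N _))
            (lin₁ (double-upper a (ev y S) (N * b (within S)))
              (≤-trans a≤hi (double-mono-≤ (hi≤ y S))))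

      0≤lo : ∀ y → 0ℤ ≤ lo y
      0≤lo y = ≤-trans
        (subst (0ℤ ≤_) (sym (trans (cong (λ v → N * p (within ⊥) - v) (ev-⊥ y)) (+-identityʳ _)))
          (subst (_≤ N * p (within ⊥)) (*-zeroʳ N) (*-monoˡ-≤-nonNeg N (p-nonneg (within ⊥)))))
        (≤max⊆ (lower y) ⊥)

      hi≤N : ∀ y → hi y ≤ N
      hi≤N y = ≤-trans (hi≤ y ⊥)
        (subst (_≤ N) (sym (trans (cong (λ v → - (v - N * b (within ⊥))) (ev-⊥ y))
          (l (N * b (within ⊥)))))
          (subst (N * b (within ⊥) ≤_) (*-identityʳ N)
            (*-monoˡ-≤-nonNeg N (subst (λ c → b (within ⊥) ≤ + c)
              (trans (∣insertAt-inside∣ ⊥ e) (cong suc (∣⊥∣≡0 k))) (b-card (within ⊥))))))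
        where
        l : ∀ x → - (0ℤ - x) ≡ x
        l = solve-∀

      -- Fourier-Motzkin elimination. Sets S and T attaining the two endpoints are uncrossed by
      -- `cross`, which leaves the constraints of the projection at S minus T and T minus S.
      lo≤hi : ∀ {y} → Below y → lo y ≤ hi y
      lo≤hi {y} below with S , eq ← max⊆-attained (lower y) | T , eq′ ← hi-attained y =
        subst₂ _≤_ (sym eq) (sym eq′)
          (lin₃ (expand (N * p (within S)) (N * b (within T)) (ev y S) (ev y T)
                   (N * b (without (T ∩ ∁ S))) (N * p (without (S ∩ ∁ T)))
                   (ev y (T ∩ ∁ S)) (ev y (S ∩ ∁ T)) (ev-differences y S T))
            crossed (proj₂ (below (T ∩ ∁ S))) (proj₁ (below (S ∩ ∁ T))))
        where
        crossed : N * b (without (T ∩ ∁ S)) + N * p (within S) ≤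
                  N * b (within T) + N * p (without (S ∩ ∁ T))
        crossed = subst₂ _≤_ (*-distribˡ-+ N _ _) (*-distribˡ-+ N _ _)
          (*-monoˡ-≤-nonNeg N (subst₂ (λ U V → b U + p (within S) ≤ b (within T) + p V)
            (insertAt-∩∁ T S e inside inside) (insertAt-∩∁ S T e inside inside)
            (cross (within T) (within S))))
        expand : ∀ pS bT yS yT bD pD yTS yST → yS + yTS ≡ yT + yST →
                 - (yT - bT) - (pS - yS) ≡
                 (bT + pD - (bD + pS)) + (bD - yTS) + (yST - pD)
        expand pS bT yS yT bD pD yTS yST eq =
          trans (l₁ pS bT yS yT yTS)
            (trans (cong (λ z → bT - pS + (z - yTS) - yT) eq) (l₂ pS bT yT bD pD yTS yST))
          where
          l₁ : ∀ pS bT yS yT yTS → - (yT - bT) - (pS - yS) ≡ bT - pS + (yS + yTS - yTS) - yT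
          l₁ = solve-∀
          l₂ : ∀ pS bT yT bD pD yTS yST → bT - pS + (yT + yST - yTS) - yT ≡
               (bT + pD - (bD + pS)) + (bD - yTS) + (yST - pD)
          l₂ = solve-∀

      eliminate-outside : ∀ y → ¬ Below y → eliminate e f y ≡ 0ℤ
      eliminate-outside y ¬below = Vanishing.V-alternating (2^ k) λ a →
        proj₂ f-ind (extend y a) (¬below ∘ above⇒below {y} {a})

    -- The fibre over y is the closed interval from `lo y` to `hi y`, nonempty exactly over the
    -- projection. The empty set as test set puts it within [0, 1], by `p-nonneg` and `b-card`, and
    -- this is the range that the 2^k even and odd pairs cover.
    eliminate-indicates : Indicates (eliminate e f) Below
    eliminate-indicates =
      (λ y below → alternating-interval (f ∘ extend y) (0≤lo y) (lo≤hi {y} below)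
        (λ a lo≤a a≤hi → proj₁ f-ind (extend y a) (below⇒above {y} below lo≤a a≤hi))
        (λ where
          a (inj₁ a<lo) → proj₂ f-ind (extend y a) λ above → <⇒≱ a<lo (above⇒lo≤ {y} above)
          a (inj₂ hi<a) → proj₂ f-ind (extend y a) λ above → <⇒≱ hi<a (above⇒≤hi {y} above))
        (2^ k) (hi≤N y)) ,
      eliminate-outside

2^-nonZero : ∀ k → ℕ.NonZero (2^ k)
2^-nonZero zero    = _
2^-nonZero (suc k) with 2^ k | 2^-nonZero k
... | suc _ | _ = _

2^-positive : ∀ k → ℤ.Positive (+ (2^ k))
2^-positive k with 2^ k | 2^-nonZero k
... | suc _ | _ = _

-- From x(⊤) ≥ α and x(∁ S) ≤ b(∁ S) follows x(S) ≥ α - b(∁ S): the lower bounds that the new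
-- constraint forces.
truncate : ℤ → (p b : Subset k → ℤ) → Subset k → ℤ
truncate α p b S = p S ⊔ (α - b (∁ S))

∁⊥≡⊤ : ∁ ⊥ ≡ ⊤ {k}
∁⊥≡⊤ {zero}  = refl
∁⊥≡⊤ {suc k} = cong (inside ∷_) ∁⊥≡⊤

∁⊤≡⊥ : ∁ ⊤ ≡ ⊥ {k}
∁⊤≡⊥ {zero}  = refl
∁⊤≡⊥ {suc k} = cong (outside ∷_) ∁⊤≡⊥

∪-∁ : ∀ (X Y : Subset k) → X ∪ ∁ Y ≡ ∁ (Y ∩ ∁ X)
∪-∁ []            []            = refl
∪-∁ (outside ∷ X) (outside ∷ Y) = cong (inside ∷_) (∪-∁ X Y)
∪-∁ (outside ∷ X) (inside ∷ Y)  = cong (outside ∷_) (∪-∁ X Y)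
∪-∁ (inside ∷ X)  (outside ∷ Y) = cong (inside ∷_) (∪-∁ X Y)
∪-∁ (inside ∷ X)  (inside ∷ Y)  = cong (inside ∷_) (∪-∁ X Y)

module _ {p b : Subset k → ℤ} (pb : Paramodular p b) (α : ℤ) where
  open Paramodular pb

  truncate-paramodular : α ≤ b ⊤ → Paramodular (truncate α p b) b
  truncate-paramodular α≤b⊤ = record
    { p-⊥      = ⊔-lub p-⊥ (subst (λ S → α - b S ≤ 0ℤ) (sym ∁⊥≡⊤) (i≤j⇒i-j≤0 α≤b⊤))
    ; p-nonneg = λ S → ≤-trans (p-nonneg S) (i≤i⊔j (p S) _)
    ; b-⊥      = b-⊥
    ; b-card   = b-card
    ; b-sub    = b-sub
    ; cross    = cross′
    }
    where
    cross′ : ∀ X Y → b (X ∩ ∁ Y) + truncate α p b Y ≤ b X + truncate α p b (Y ∩ ∁ X)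
    cross′ X Y with ⊔-sel (p Y) (α - b (∁ Y))
    ... | inj₁ eq rewrite eq =
      ≤-trans (cross X Y) (+-monoʳ-≤ (b X) (i≤i⊔j (p (Y ∩ ∁ X)) _))
    -- The forced lower bound turns `cross` into submodularity of `b` at X and ∁ Y, because X ∪ ∁ Y
    -- is the complement of Y minus X.
    ... | inj₂ eq rewrite eq =
      ≤-trans (lin₁ (l (b X) (b (∁ Y)) (b (∁ (Y ∩ ∁ X))) (b (X ∩ ∁ Y)) α)
                 (subst (λ U → b U + b (X ∩ ∁ Y) ≤ b X + b (∁ Y)) (∪-∁ X Y) (b-sub X (∁ Y))))
              (+-monoʳ-≤ (b X) (i≤j⊔i (p (Y ∩ ∁ X)) _))
      where
      l : ∀ x y u i α → x + (α - u) - (i + (α - y)) ≡ x + y - (u + i)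
      l = solve-∀

  module _ (N : ℕ) (x : Vec ℤ k) where

    truncate-sound : InPolytope N (truncate α p b) b x →
                     InPolytope N p b x × + N * α ≤ ev x ⊤
    truncate-sound x∈ =
      (λ S → ≤-trans (*-monoˡ-≤-nonNeg (+ N) (i≤i⊔j (p S) _)) (proj₁ (x∈ S)) , proj₂ (x∈ S)) ,
      ≤-trans (*-monoˡ-≤-nonNeg (+ N) (≤-trans (≤-reflexive (sym α-b⊥)) (i≤j⊔i (p ⊤) _)))
              (proj₁ (x∈ ⊤))
      where
      α-b⊥ : α - b (∁ ⊤) ≡ α
      α-b⊥ = trans (cong (λ v → α - v) (trans (cong b ∁⊤≡⊥) b-⊥)) (+-identityʳ α)

    truncate-complete : InPolytope N p b x → + N * α ≤ ev x ⊤ →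
                        InPolytope N (truncate α p b) b x
    truncate-complete x∈ α≤x S = lower , proj₂ (x∈ S)
      where
      l : ∀ s t n α b → s - n * (α - b) ≡ (s + t - n * α) + (n * b - t)
      l = solve-∀
      lower : + N * truncate α p b S ≤ ev x S
      lower with ⊔-sel (p S) (α - b (∁ S))
      ... | inj₁ eq rewrite eq = proj₁ (x∈ S)
      ... | inj₂ eq rewrite eq =
        lin₂ (l (ev x S) (ev x (∁ S)) (+ N) α (b (∁ S)))
          (subst (+ N * α ≤_) (sym (ev-∁ x S)) α≤x) (proj₂ (x∈ (∁ S)))

module _ {p b : Subset k → ℤ} (pb : Paramodular p b) {f : Vec ℤ k → ℤ}
         (f-ind : Indicates f (InPolytope (2^ k) p b)) (α : ℤ) where

  restrictTo-indicates :
    Indicates (restrictTo α f) (InPolytope (2^ k) (truncate α p b) b)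
  proj₁ restrictTo-indicates x x∈
    with x∈′ , α≤x ← truncate-sound pb α (2^ k) x x∈
    rewrite dec-true (+ (2^ k) * α ≤? ev x ⊤) α≤x = proj₁ f-ind x x∈′
  proj₂ restrictTo-indicates x x∉ with + (2^ k) * α ≤? ev x ⊤
  ... | yes α≤x = proj₂ f-ind x λ x∈ → x∉ (truncate-complete pb α (2^ k) x x∈ α≤x)
  ... | no  _   = refl

  restrictTo-infeasible : ¬ α ≤ b ⊤ → ∀ x → restrictTo α f x ≡ 0ℤ
  restrictTo-infeasible α≰b⊤ x with + (2^ k) * α ≤? ev x ⊤
  ... | no  _   = refl
  ... | yes α≤x = proj₂ f-ind x λ x∈ → α≰b⊤
    (*-cancelˡ-≤-pos α (b ⊤) (+ (2^ k)) {{2^-positive k}} (≤-trans α≤x (proj₂ (x∈ ⊤))))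

-- Every step replaces the polytope by its projection and every guard by its truncation, so
-- nonemptiness survives to dimension zero if all guards can be met. A guard that cannot be met
-- makes the function vanish identically.
χ-indicates : (π : Plan k) {p b : Subset k → ℤ} → Paramodular p b →
  ∀ {f} → Indicates f (InPolytope (2^ k) p b) →
  (Admits π b → χ π f ≡ 1ℤ) × (¬ Admits π b → χ π f ≡ 0ℤ)
-- No coordinate is left; `p-⊥` and `b-⊥` say that the remaining polytope is a point and not empty.
χ-indicates [] {p} {b} pb f-ind =
  (λ _ → proj₁ f-ind [] λ where
    [] → subst (_≤ 0ℤ) (sym (*-identityˡ (p []))) p-⊥ ,
         ≤-reflexive (sym (trans (*-identityˡ (b [])) b-⊥))) ,
  (λ ¬admits → contradiction _ ¬admits)
  where open Paramodular pb
χ-indicates (step e π) pb f-ind =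
  χ-indicates π (delete-paramodular pb e) (eliminate-indicates pb e _ f-ind)
χ-indicates (guard α π) {b = b} pb f-ind with α ≤? b ⊤
... | no α≰b⊤ =
  (λ (α≤b⊤ , _) → contradiction α≤b⊤ α≰b⊤) ,
  (λ _ → Vanishing.V-χ π (restrictTo-infeasible pb f-ind α α≰b⊤))
... | yes α≤b⊤
  with one , zero′ ← χ-indicates π (truncate-paramodular pb α α≤b⊤)
                       (restrictTo-indicates pb f-ind α) =
  (λ (_ , admits) → one admits) ,
  (λ ¬admits → zero′ λ admits → ¬admits (α≤b⊤ , admits))

-- Plans that test rank conditions on a set and on a chain

eliminateAll : ∀ k → Plan k
eliminateAll zero    = []
eliminateAll (suc k) = step zero (eliminateAll k)

admits-eliminateAll : ∀ k {b} → Admits (eliminateAll k) b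
admits-eliminateAll zero    = _
admits-eliminateAll (suc k) = admits-eliminateAll k

∉⇒lookup : ∀ {S : Subset k} {e} → e ∉ S → lookup S e ≡ outside
∉⇒lookup {S = S} {e} e∉S with lookup S e in eq
... | outside = refl
... | inside  = contradiction (lookup⇒[]= e S eq) e∉S

insertAt-removeAt-∉ : ∀ {S : Subset (suc k)} {e} → e ∉ S →
                      insertAt (removeAt S e) e outside ≡ S
insertAt-removeAt-∉ {S = S} {e} e∉S =
  trans (cong (insertAt (removeAt S e) e) (sym (∉⇒lookup e∉S))) (insertAt-removeAt S e)

removeAt-⊆ : ∀ {S T : Subset (suc k)} → S ⊆ T → ∀ e → removeAt S e ⊆ removeAt T e
removeAt-⊆ {S = _ ∷ _}     {T = _ ∷ _}     S⊆T zero    = drop-∷-⊆ S⊆T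
removeAt-⊆ {S = _ ∷ _ ∷ _} {T = _ ∷ _ ∷ _} S⊆T (suc e) {zero} here with here ← S⊆T here = here
removeAt-⊆ {S = _ ∷ _ ∷ _} {T = _ ∷ _ ∷ _} S⊆T (suc e) {suc x} (there x∈) =
  there (removeAt-⊆ (drop-∷-⊆ S⊆T) e x∈)

¬nonempty-∁ : ∀ {S : Subset k} → ¬ Nonempty (∁ S) → S ≡ ⊤
¬nonempty-∁ {S = S} empty = ⊆-antisym ⊆⊤ λ {x} _ →
  x∉∁p⇒x∈p λ x∈ → empty (x , x∈)

-- Once the coordinates outside F are gone, x(⊤) is x(F).
boundPlan : (F : Subset k) → ℤ → Plan k
boundPlan {zero}  F i = guard i []
boundPlan {suc k} F i with nonempty? (∁ F)
... | yes (e , _) = step e (boundPlan (removeAt F e) i)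
... | no  _       = guard i (eliminateAll (suc k))

boundPlan₂ : (F T : Subset k) → ℤ → ℤ → Plan k
boundPlan₂ {zero}  F T i j = guard j (boundPlan F i)
boundPlan₂ {suc k} F T i j with nonempty? (∁ T)
... | yes (e , _) = step e (boundPlan₂ (removeAt F e) (removeAt T e) i j)
... | no  _       = guard j (boundPlan F i)

admits-boundPlan : ∀ (F : Subset k) i b → Admits (boundPlan F i) b ⇔ i ≤ b F
admits-boundPlan {zero}  [] i b = mk⇔ proj₁ (_, _)
admits-boundPlan {suc k} F  i b with nonempty? (∁ F)
... | yes (e , e∈) = subst (λ S → Admits (boundPlan (removeAt F e) i) _ ⇔ i ≤ b S)
  (insertAt-removeAt-∉ (x∈∁p⇒x∉p e∈))
  (admits-boundPlan (removeAt F e) i (λ S → b (insertAt S e outside)))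
... | no  empty rewrite ¬nonempty-∁ empty =
  mk⇔ proj₁ (λ i≤ → i≤ , admits-eliminateAll (suc k) {b})

admits-boundPlan₂ : ∀ (F T : Subset k) → F ⊆ T → ∀ i j b →
                    Admits (boundPlan₂ F T i j) b ⇔ (j ≤ b T × i ≤ b F)
admits-boundPlan₂ {zero}  [] [] F⊆T i j b = mk⇔
  (λ (j≤ , i≤ , _) → j≤ , i≤) (λ (j≤ , i≤) → j≤ , i≤ , _)
admits-boundPlan₂ {suc k} F T F⊆T i j b with nonempty? (∁ T)
... | yes (e , e∈) = subst₂
  (λ S U → Admits (boundPlan₂ (removeAt F e) (removeAt T e) i j) _ ⇔ (j ≤ b S × i ≤ b U))
  (insertAt-removeAt-∉ (x∈∁p⇒x∉p e∈))
  -- Here nestedness enters: a coordinate eliminated for lying outside T also lies outside F, so F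
  -- survives for the second guard.
  (insertAt-removeAt-∉ (x∈∁p⇒x∉p e∈ ∘ F⊆T))
  (admits-boundPlan₂ (removeAt F e) (removeAt T e) (removeAt-⊆ F⊆T e) i j
    (λ S → b (insertAt S e outside)))
... | no  empty rewrite ¬nonempty-∁ empty = mk⇔
  (λ (j≤ , admits) → j≤ , Equivalence.to (admits-boundPlan F i b) admits)
  (λ (j≤ , i≤) → j≤ , Equivalence.from (admits-boundPlan F i b) i≤)

-- The rank function of a matroid

∈-subsets : ∀ (S : Subset n) → S List.∈ subsets n
∈-subsets []            = Any.here refl
∈-subsets (outside ∷ S) = List.∈-++⁺ˡ (List.∈-map⁺ (outside ∷_) (∈-subsets S))
∈-subsets (inside ∷ S)  =
  List.∈-++⁺ʳ (List.map (outside ∷_) (subsets _)) (List.∈-map⁺ (inside ∷_) (∈-subsets S))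

∣∩⊥∣ : ∀ (S : Subset n) → ∣ S ∩ ⊥ ∣ ≡ 0
∣∩⊥∣ {n} S = trans (cong ∣_∣ (∩-zeroʳ S)) (∣⊥∣≡0 n)

∣∩⁅x⁆∣-∈ : ∀ {S : Subset n} {x} → x ∈ S → ∣ S ∩ ⁅ x ⁆ ∣ ≡ 1
∣∩⁅x⁆∣-∈ {S = _ ∷ S}       here       = cong suc (∣∩⊥∣ S)
∣∩⁅x⁆∣-∈ {S = outside ∷ S} (there x∈) = ∣∩⁅x⁆∣-∈ x∈
∣∩⁅x⁆∣-∈ {S = inside ∷ S}  (there x∈) = ∣∩⁅x⁆∣-∈ x∈

∣∩⁅x⁆∣-∉ : ∀ {S : Subset n} {x} → x ∉ S → ∣ S ∩ ⁅ x ⁆ ∣ ≡ 0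
∣∩⁅x⁆∣-∉ {S = outside ∷ S} {zero}  x∉ = ∣∩⊥∣ S
∣∩⁅x⁆∣-∉ {S = inside ∷ S}  {zero}  x∉ = contradiction here x∉
∣∩⁅x⁆∣-∉ {S = outside ∷ S} {suc x} x∉ = ∣∩⁅x⁆∣-∉ (x∉ ∘ there)
∣∩⁅x⁆∣-∉ {S = inside ∷ S}  {suc x} x∉ = ∣∩⁅x⁆∣-∉ (x∉ ∘ there)

∣∩-remove∣ : ∀ (S : Subset n) {B x} → x ∈ B →
             ∣ S ∩ (B ∖ x) ∣ ℕ.+ ∣ S ∩ ⁅ x ⁆ ∣ ≡ ∣ S ∩ B ∣
∣∩-remove∣ {n = suc n} (outside ∷ S) {_ ∷ B} here =
  trans (cong₂ (λ C c → ∣ S ∩ C ∣ ℕ.+ c) (p─⊥≡p B) (∣∩⊥∣ S)) (ℕ.+-identityʳ _)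
∣∩-remove∣ {n = suc n} (inside ∷ S) {_ ∷ B} here =
  trans (cong₂ (λ C c → ∣ S ∩ C ∣ ℕ.+ suc c) (p─⊥≡p B) (∣∩⊥∣ S)) (ℕ.+-comm _ 1)
∣∩-remove∣ (outside ∷ S) {_ ∷ B}       (there x∈) = ∣∩-remove∣ S x∈
∣∩-remove∣ (inside ∷ S)  {outside ∷ B} (there x∈) = ∣∩-remove∣ S x∈
∣∩-remove∣ (inside ∷ S)  {inside ∷ B}  (there x∈) = cong suc (∣∩-remove∣ S x∈)

∣∩-add∣ : ∀ (S : Subset n) {B y} → y ∉ B →
          ∣ S ∩ (B ∪ ⁅ y ⁆) ∣ ≡ ∣ S ∩ B ∣ ℕ.+ ∣ S ∩ ⁅ y ⁆ ∣
∣∩-add∣ S             {inside ∷ B}  {zero}  y∉ = contradiction here y∉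
∣∩-add∣ {n = suc n} (outside ∷ S) {outside ∷ B} {zero} y∉
  rewrite ∪-identityʳ B | ∣∩⊥∣ S = sym (ℕ.+-identityʳ _)
∣∩-add∣ {n = suc n} (inside ∷ S)  {outside ∷ B} {zero} y∉
  rewrite ∪-identityʳ B | ∣∩⊥∣ S = sym (ℕ.+-comm _ 1)
∣∩-add∣ (outside ∷ S) {_ ∷ B}       {suc y} y∉ = ∣∩-add∣ S (y∉ ∘ there)
∣∩-add∣ (inside ∷ S)  {outside ∷ B} {suc y} y∉ = ∣∩-add∣ S (y∉ ∘ there)
∣∩-add∣ (inside ∷ S)  {inside ∷ B}  {suc y} y∉ = cong suc (∣∩-add∣ S (y∉ ∘ there))

∣∩-exchange∣ : ∀ (S : Subset n) {B x y} → x ∈ B → y ∉ B →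
               ∣ S ∩ ((B ∖ x) ∪ ⁅ y ⁆) ∣ ℕ.+ ∣ S ∩ ⁅ x ⁆ ∣ ≡ ∣ S ∩ B ∣ ℕ.+ ∣ S ∩ ⁅ y ⁆ ∣
∣∩-exchange∣ S {B} {x} {y} x∈B y∉B = begin
  ∣ S ∩ ((B ∖ x) ∪ ⁅ y ⁆) ∣ ℕ.+ ∣ S ∩ ⁅ x ⁆ ∣
    ≡⟨ cong (ℕ._+ ∣ S ∩ ⁅ x ⁆ ∣) (∣∩-add∣ S (y∉B ∘ p─q⊆p B ⁅ x ⁆)) ⟩
  ∣ S ∩ (B ∖ x) ∣ ℕ.+ ∣ S ∩ ⁅ y ⁆ ∣ ℕ.+ ∣ S ∩ ⁅ x ⁆ ∣
    ≡⟨ ℕ.+-assoc ∣ S ∩ (B ∖ x) ∣ _ _ ⟩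
  ∣ S ∩ (B ∖ x) ∣ ℕ.+ (∣ S ∩ ⁅ y ⁆ ∣ ℕ.+ ∣ S ∩ ⁅ x ⁆ ∣)
    ≡⟨ cong (ℕ._+_ ∣ S ∩ (B ∖ x) ∣) (ℕ.+-comm ∣ S ∩ ⁅ y ⁆ ∣ _) ⟩
  ∣ S ∩ (B ∖ x) ∣ ℕ.+ (∣ S ∩ ⁅ x ⁆ ∣ ℕ.+ ∣ S ∩ ⁅ y ⁆ ∣)
    ≡⟨ ℕ.+-assoc ∣ S ∩ (B ∖ x) ∣ _ _ ⟨
  ∣ S ∩ (B ∖ x) ∣ ℕ.+ ∣ S ∩ ⁅ x ⁆ ∣ ℕ.+ ∣ S ∩ ⁅ y ⁆ ∣
    ≡⟨ cong (ℕ._+ ∣ S ∩ ⁅ y ⁆ ∣) (∣∩-remove∣ S x∈B) ⟩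
  ∣ S ∩ B ∣ ℕ.+ ∣ S ∩ ⁅ y ⁆ ∣ ∎
  where open ≡-Reasoning

exchange-grows : ∀ (S : Subset n) {B x y} → x ∈ B → y ∉ B → x ∉ S →
                 ∣ S ∩ B ∣ ℕ.≤ ∣ S ∩ ((B ∖ x) ∪ ⁅ y ⁆) ∣
exchange-grows S {B} {x} {y} x∈B y∉B x∉S = subst (∣ S ∩ B ∣ ℕ.≤_)
  (trans (sym (∣∩-exchange∣ S x∈B y∉B))
    (trans (cong (ℕ._+_ _) (∣∩⁅x⁆∣-∉ x∉S)) (ℕ.+-identityʳ _)))
  (ℕ.m≤m+n ∣ S ∩ B ∣ ∣ S ∩ ⁅ y ⁆ ∣)

exchange-gains : ∀ (S : Subset n) {B x y} → x ∈ B → y ∉ B → x ∉ S → y ∈ S →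
                 ∣ S ∩ ((B ∖ x) ∪ ⁅ y ⁆) ∣ ≡ suc ∣ S ∩ B ∣
exchange-gains S {B} {x} {y} x∈B y∉B x∉S y∈S =
  trans (sym (trans (cong (ℕ._+_ _) (∣∩⁅x⁆∣-∉ x∉S)) (ℕ.+-identityʳ _)))
    (trans (∣∩-exchange∣ S x∈B y∉B)
      (trans (cong (ℕ._+_ _) (∣∩⁅x⁆∣-∈ y∈S)) (ℕ.+-comm _ 1)))

∣⊤∩∣ : ∀ (S : Subset n) → ∣ ⊤ ∩ S ∣ ≡ ∣ S ∣
∣⊤∩∣ S = cong ∣_∣ (∩-identityˡ S)

∣exchange∣ : ∀ {B : Subset n} {x y} → x ∈ B → y ∉ B → ∣ (B ∖ x) ∪ ⁅ y ⁆ ∣ ≡ ∣ B ∣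
∣exchange∣ {n} {B} {x} {y} x∈B y∉B = ℕ.+-cancelʳ-≡ 1 _ _ (begin
  ∣ C ∣ ℕ.+ 1                       ≡⟨ cong₂ ℕ._+_ (∣⊤∩∣ C) (∣∩⁅x⁆∣-∈ (∈⊤ {x = x})) ⟨
  ∣ ⊤ ∩ C ∣ ℕ.+ ∣ ⊤ ∩ ⁅ x ⁆ ∣       ≡⟨ ∣∩-exchange∣ ⊤ x∈B y∉B ⟩
  ∣ ⊤ ∩ B ∣ ℕ.+ ∣ ⊤ ∩ ⁅ y ⁆ ∣       ≡⟨ cong₂ ℕ._+_ (∣⊤∩∣ B) (∣∩⁅x⁆∣-∈ (∈⊤ {x = y})) ⟩
  ∣ B ∣ ℕ.+ 1                       ∎)
  where
  open ≡-Reasoning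
  C : Subset n
  C = (B ∖ x) ∪ ⁅ y ⁆

∣∩∣+∣∁∩∣ : ∀ (S B : Subset n) → ∣ S ∩ B ∣ ℕ.+ ∣ ∁ S ∩ B ∣ ≡ ∣ B ∣
∣∩∣+∣∁∩∣ []            []            = refl
∣∩∣+∣∁∩∣ (outside ∷ S) (outside ∷ B) = ∣∩∣+∣∁∩∣ S B
∣∩∣+∣∁∩∣ (outside ∷ S) (inside ∷ B)  = trans (ℕ.+-suc _ _) (cong suc (∣∩∣+∣∁∩∣ S B))
∣∩∣+∣∁∩∣ (inside ∷ S)  (outside ∷ B) = ∣∩∣+∣∁∩∣ S B
∣∩∣+∣∁∩∣ (inside ∷ S)  (inside ∷ B)  = cong suc (∣∩∣+∣∁∩∣ S B)

∣p∣≤∣p∩q∣⇒p∩q≡p : ∀ (p q : Subset n) → ∣ p ∣ ℕ.≤ ∣ p ∩ q ∣ → p ∩ q ≡ p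
∣p∣≤∣p∩q∣⇒p∩q≡p []            []            le = refl
∣p∣≤∣p∩q∣⇒p∩q≡p (outside ∷ p) (_ ∷ q)       le = cong (outside ∷_) (∣p∣≤∣p∩q∣⇒p∩q≡p p q le)
∣p∣≤∣p∩q∣⇒p∩q≡p (inside ∷ p)  (inside ∷ q)  le =
  cong (inside ∷_) (∣p∣≤∣p∩q∣⇒p∩q≡p p q (ℕ.s≤s⁻¹ le))
∣p∣≤∣p∩q∣⇒p∩q≡p (inside ∷ p)  (outside ∷ q) le =
  contradiction (∣p∩q∣≤∣p∣ p q) (ℕ.<⇒≱ le)

∩-monoˡ-⊆ : ∀ {S T : Subset n} B → S ⊆ T → S ∩ B ⊆ T ∩ B
∩-monoˡ-⊆ {S = S} B S⊆T x∈ =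
  let x∈S , x∈B = x∈p∩q⁻ S B x∈ in x∈p∩q⁺ (S⊆T x∈S , x∈B)

module Rank {E : GroundSet} (M : Matroid E) where
  open Matroid M

  rk-upper : ∀ S {B} → IsBasis B → ∣ S ∩ B ∣ ℕ.≤ rk M S
  rk-upper S {B} B-basis = All.lookup (xs≤max 0 _)
    (List.∈-map⁺ (λ B → ∣ S ∩ B ∣) (List.∈-filter⁺ isBasis? (∈-subsets B) B-basis))

  rk-attained : ∀ S → ∃ λ B → IsBasis B × rk M S ≡ ∣ S ∩ B ∣
  rk-attained S with argmax-sel id 0 (List.map (λ B → ∣ S ∩ B ∣) (List.filter isBasis? (subsets _)))
  ... | inj₁ rk≡0 = let B , B-basis = nonempty in
    B , B-basis , trans rk≡0 (sym (ℕ.n≤0⇒n≡0 (subst (∣ S ∩ B ∣ ℕ.≤_) rk≡0 (rk-upper S B-basis))))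
  ... | inj₂ rk∈ =
    let B , B∈ , eq = List.∈-map⁻ (λ B → ∣ S ∩ B ∣) rk∈
    in B , proj₂ (List.∈-filter⁻ isBasis? {xs = subsets _} B∈) , eq

  rk-mono : ∀ {S T} → S ⊆ T → rk M S ℕ.≤ rk M T
  rk-mono {S} {T} S⊆T with B , B-basis , eq ← rk-attained S = begin
    rk M S      ≡⟨ eq ⟩
    ∣ S ∩ B ∣   ≤⟨ p⊆q⇒∣p∣≤∣q∣ (∩-monoˡ-⊆ B S⊆T) ⟩
    ∣ T ∩ B ∣   ≤⟨ rk-upper T B-basis ⟩
    rk M T      ∎
    where open ℕ.≤-Reasoning

  rk≤∣∣ : ∀ S → rk M S ℕ.≤ ∣ S ∣
  rk≤∣∣ S with B , _ , eq ← rk-attained S = subst (ℕ._≤ ∣ S ∣) (sym eq) (∣p∩q∣≤∣p∣ S B)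

  rk-⊥ : rk M ⊥ ≡ 0
  rk-⊥ = ℕ.n≤0⇒n≡0 (subst (rk M ⊥ ℕ.≤_) (∣⊥∣≡0 (size E)) (rk≤∣∣ ⊥))

  private
    -- Induction on the bound d for the number of elements of C missing from B. An exchange keeps
    -- the size of B and gains an element of C; at d = 0 the set C is contained in B, so no exchange
    -- partner exists.
    basis-card-≤ : ∀ d {B C} → IsBasis B → IsBasis C →
                   ∣ C ∣ ℕ.≤ d ℕ.+ ∣ C ∩ B ∣ → ∣ B ∣ ℕ.≤ ∣ C ∣
    basis-card-≤ d {B} {C} B-basis C-basis close with nonempty? (B ∩ ∁ C)
    ... | no empty = p⊆q⇒∣p∣≤∣q∣ λ {x} x∈B → x∉∁p⇒x∈p λ x∈∁C →
      empty (x , x∈p∩q⁺ (x∈B , x∈∁C))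
    ... | yes (x , x∈)
      with x∈B , x∈∁C ← x∈p∩q⁻ B (∁ C) x∈
      with y , y∈C , y∉B , basis ← exchange B-basis C-basis x∈B (x∈∁p⇒x∉p x∈∁C)
      with d
    ...   | zero  = contradiction
      (p∩q⊆q C B (subst (y ∈_) (sym (∣p∣≤∣p∩q∣⇒p∩q≡p C B close)) y∈C)) y∉B
    ...   | suc d = subst (ℕ._≤ ∣ C ∣) (∣exchange∣ x∈B y∉B)
      (basis-card-≤ d basis C-basis
        (subst (∣ C ∣ ℕ.≤_)
          (trans (sym (ℕ.+-suc d _))
            (cong (ℕ._+_ d) (sym (exchange-gains C x∈B y∉B (x∈∁p⇒x∉p x∈∁C) y∈C)))) close))

    bases-equicardinal : ∀ {B C} → IsBasis B → IsBasis C → ∣ B ∣ ≡ ∣ C ∣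
    bases-equicardinal {B} {C} B-basis C-basis = ℕ.≤-antisym
      (basis-card-≤ ∣ C ∣ B-basis C-basis (ℕ.m≤m+n _ _))
      (basis-card-≤ ∣ B ∣ C-basis B-basis (ℕ.m≤m+n _ _))

  rk-⊤≤∣basis∣ : ∀ {B} → IsBasis B → rk M ⊤ ℕ.≤ ∣ ⊤ ∩ B ∣
  rk-⊤≤∣basis∣ {B} B-basis with C , C-basis , eq ← rk-attained ⊤ = ℕ.≤-reflexive
    (trans eq (trans (∣⊤∩∣ C) (trans (bases-equicardinal C-basis B-basis) (sym (∣⊤∩∣ B)))))

  -- Exchanging elements of B \ Y for elements of C \ B never decreases
  -- |X ∩ B|, and it brings B closer to C.
  private
    simultaneous : ∀ d {X Y B C} → X ⊆ Y → IsBasis B → IsBasis C →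
      ∣ C ∣ ℕ.≤ d ℕ.+ ∣ C ∩ B ∣ →
      ∃ λ D → IsBasis D × ∣ X ∩ B ∣ ℕ.≤ ∣ X ∩ D ∣ × ∣ Y ∩ C ∣ ℕ.≤ ∣ Y ∩ D ∣
    simultaneous d {X} {Y} {B} {C} X⊆Y B-basis C-basis close
      with nonempty? ((B ∩ ∁ C) ∩ ∁ Y)
    -- Now B has no more elements outside Y than C has. Bases being equicardinal, it has at least as
    -- many inside Y.
    ... | no empty = B , B-basis , ℕ.≤-refl , ℕ.+-cancelʳ-≤ ∣ ∁ Y ∩ B ∣ _ _ (begin
        ∣ Y ∩ C ∣ ℕ.+ ∣ ∁ Y ∩ B ∣  ≤⟨ ℕ.+-monoʳ-≤ ∣ Y ∩ C ∣ (p⊆q⇒∣p∣≤∣q∣ outer) ⟩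
        ∣ Y ∩ C ∣ ℕ.+ ∣ ∁ Y ∩ C ∣  ≡⟨ ∣∩∣+∣∁∩∣ Y C ⟩
        ∣ C ∣                      ≡⟨ bases-equicardinal C-basis B-basis ⟩
        ∣ B ∣                      ≡⟨ ∣∩∣+∣∁∩∣ Y B ⟨
        ∣ Y ∩ B ∣ ℕ.+ ∣ ∁ Y ∩ B ∣  ∎)
      where
      open ℕ.≤-Reasoning
      outer : ∁ Y ∩ B ⊆ ∁ Y ∩ C
      outer {x} x∈ = let x∈∁Y , x∈B = x∈p∩q⁻ (∁ Y) B x∈ in
        x∈p∩q⁺ (x∈∁Y , x∉∁p⇒x∈p λ x∈∁C →
          empty (x , x∈p∩q⁺ (x∈p∩q⁺ (x∈B , x∈∁C) , x∈∁Y)))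
    ... | yes (x , x∈)
      with x∈B∖C , x∈∁Y ← x∈p∩q⁻ (B ∩ ∁ C) (∁ Y) x∈
      with x∈B , x∈∁C ← x∈p∩q⁻ B (∁ C) x∈B∖C
      with y , y∈C , y∉B , basis ← exchange B-basis C-basis x∈B (x∈∁p⇒x∉p x∈∁C)
      with d
    ...   | zero  = contradiction
      (p∩q⊆q C B (subst (y ∈_) (sym (∣p∣≤∣p∩q∣⇒p∩q≡p C B close)) y∈C)) y∉B
    ...   | suc d =
      let D , D-basis , X≤ , Y≤ = simultaneous d X⊆Y basis C-basis
            (subst (∣ C ∣ ℕ.≤_)
              (trans (sym (ℕ.+-suc d _))
                (cong (ℕ._+_ d) (sym (exchange-gains C x∈B y∉B (x∈∁p⇒x∉p x∈∁C) y∈C)))) close)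
      in D , D-basis ,
         ℕ.≤-trans (exchange-grows X x∈B y∉B (x∈∁p⇒x∉p x∈∁Y ∘ X⊆Y)) X≤ , Y≤

  r : Subset (size E) → ℤ
  r S = + rk M S

  -- Since X ∩ Y ⊆ X ∪ Y, one basis D attains both ranks on the left. Counting elements of D is
  -- modular, and the counts for X and Y are bounded by their ranks.
  r-submodular : ∀ X Y → r (X ∪ Y) + r (X ∩ Y) ≤ r X + r Y
  r-submodular X Y
    with B , B-basis , B-eq ← rk-attained (X ∩ Y)
       | C , C-basis , C-eq ← rk-attained (X ∪ Y)
    with D , D-basis , D∩ , D∪ ←
      simultaneous ∣ C ∣ (p⊆p∪q Y ∘ p∩q⊆p X Y) B-basis C-basis (ℕ.m≤m+n _ _)
    = begin
    r (X ∪ Y) + r (X ∩ Y)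
      ≡⟨ cong₂ (λ c b → + c + + b) C-eq B-eq ⟩
    + ∣ (X ∪ Y) ∩ C ∣ + + ∣ (X ∩ Y) ∩ B ∣
      ≤⟨ +-mono-≤ (+≤+ D∪) (+≤+ D∩) ⟩
    + ∣ (X ∪ Y) ∩ D ∣ + + ∣ (X ∩ Y) ∩ D ∣
      ≡⟨ cong₂ _+_ (ev-indicator D (X ∪ Y)) (ev-indicator D (X ∩ Y)) ⟨
    ev (indicator D) (X ∪ Y) + ev (indicator D) (X ∩ Y)
      ≡⟨ ev-∪-∩ (indicator D) X Y ⟩
    ev (indicator D) X + ev (indicator D) Y
      ≡⟨ cong₂ _+_ (ev-indicator D X) (ev-indicator D Y) ⟩
    + ∣ X ∩ D ∣ + + ∣ Y ∩ D ∣
      ≤⟨ +-mono-≤ (+≤+ (rk-upper X D-basis)) (+≤+ (rk-upper Y D-basis)) ⟩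
    r X + r Y ∎
    where open ≤-Reasoning

  -- With lower function zero this is the independence polytope; the base polytope is its truncation
  -- at `r ⊤`.
  r-paramodular : Paramodular (λ _ → 0ℤ) r
  r-paramodular = record
    { p-⊥      = ≤-refl
    ; p-nonneg = λ _ → ≤-refl
    ; b-⊥      = cong +_ rk-⊥
    ; b-card   = λ S → +≤+ (rk≤∣∣ S)
    ; b-sub    = r-submodular
    ; cross    = λ X Y → +-monoˡ-≤ 0ℤ (+≤+ (rk-mono (p∩q⊆p X (∁ Y))))
    }

-- Integer decomposition of dilated base polytopes

ev-⁅⁆ : ∀ (x : Vec ℤ k) i → ev x ⁅ i ⁆ ≡ lookup x i
ev-⁅⁆ (a ∷ x) zero    = trans (cong (_+_ a) (ev-⊥ x)) (+-identityʳ a)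
ev-⁅⁆ (a ∷ x) (suc i) = ev-⁅⁆ x i

infixl 6 _⊖_
_⊖_ : Vec ℤ k → Vec ℤ k → Vec ℤ k
[]      ⊖ []      = []
(a ∷ x) ⊖ (b ∷ y) = (a - b) ∷ (x ⊖ y)

ev-⊖ : ∀ (x y : Vec ℤ k) S → ev (x ⊖ y) S ≡ ev x S - ev y S
ev-⊖ []      []      []            = refl
ev-⊖ (a ∷ x) (b ∷ y) (outside ∷ S) = ev-⊖ x y S
ev-⊖ (a ∷ x) (b ∷ y) (inside ∷ S)  =
  trans (cong (_+_ (a - b)) (ev-⊖ x y S)) (l a b (ev x S) (ev y S))
  where
  l : ∀ a b s t → (a - b) + (s - t) ≡ (a + s) - (b + t)
  l = solve-∀

lookup-⊖ : ∀ (x y : Vec ℤ k) i → lookup x i ≡ lookup y i + lookup (x ⊖ y) i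
lookup-⊖ (a ∷ x) (b ∷ y) zero    = l a b
  where
  l : ∀ a b → a ≡ b + (a - b)
  l = solve-∀
lookup-⊖ (a ∷ x) (b ∷ y) (suc i) = lookup-⊖ x y i

0≤i≤1 : ∀ {i} → 0ℤ ≤ i → i ≤ 1ℤ → ∃ λ s → i ≡ (if s then 1ℤ else 0ℤ)
0≤i≤1 {+ 0}             _  _ = outside , refl
0≤i≤1 {+ 1}             _  _ = inside , refl
0≤i≤1 {+ suc (suc _)}   _  (+≤+ (ℕ.s≤s ()))
0≤i≤1 { -[1+ _ ]}       () _

zero-one-vector : ∀ (m : Vec ℤ k) → (∀ i → 0ℤ ≤ lookup m i) → (∀ i → lookup m i ≤ 1ℤ) →
                  ∃ λ B → m ≡ indicator B
zero-one-vector []      _   _   = [] , refl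
zero-one-vector (a ∷ m) 0≤m m≤1 =
  let s , eq  = 0≤i≤1 (0≤m zero) (m≤1 zero)
      B , eqs = zero-one-vector m (0≤m ∘ suc) (m≤1 ∘ suc)
  in s ∷ B , cong₂ _∷_ eq eqs

module Decomposition {E : GroundSet} (M : Matroid E) where
  open Matroid M
  open Rank M

  -- Edmonds' description of N · P(M).
  InBase : ℕ → Vec ℤ (size E) → Set
  InBase N z = (∀ S → ev z S ≤ + N * r S) × + N * r ⊤ ≤ ev z ⊤

  r⁅⁆≤1 : ∀ i → r ⁅ i ⁆ ≤ 1ℤ
  r⁅⁆≤1 i = subst (λ c → r ⁅ i ⁆ ≤ + c) (∣⁅x⁆∣≡1 i) (+≤+ (rk≤∣∣ ⁅ i ⁆))

  -- Nonnegativity follows by complementation: z(S) = z(⊤) - z(∁ S) ≥ N r(⊤) - N r(∁ S) ≥ 0.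
  inBase-nonneg : ∀ N {z} → InBase N z → ∀ S → 0ℤ ≤ ev z S
  inBase-nonneg N {z} (upper , top) S = lin₃
    (l (ev z S) (ev z (∁ S)) (ev z ⊤) (+ N * r ⊤) (+ N * r (∁ S)) (ev-∁ z S))
    top (upper (∁ S)) (*-monoˡ-≤-nonNeg (+ N) (+≤+ (rk-mono {∁ S} ⊆⊤)))
    where
    l : ∀ s t u a b → s + t ≡ u → s - 0ℤ ≡ (u - a) + (b - t) + (a - b)
    l s t u a b refl = l′ s t a b
      where
      l′ : ∀ s t a b → s - 0ℤ ≡ (s + t - a) + (b - t) + (a - b)
      l′ = solve-∀

  -- The singleton constraints make m a 0/1 vector, hence the indicator of some B. The constraint at
  -- B says that B lies in a basis C, and the constraint on the total that C is no larger than B.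
  basis-of-vector : ∀ m → InBase 1 m → ∃ λ B → IsBasis B × m ≡ indicator B
  basis-of-vector m (upper , top)
    with B , refl ← zero-one-vector m
      (λ i → subst (0ℤ ≤_) (ev-⁅⁆ m i) (inBase-nonneg 1 {m} (upper , top) ⁅ i ⁆))
      (λ i → subst (_≤ 1ℤ) (ev-⁅⁆ m i) (≤-trans (upper ⁅ i ⁆)
        (≤-trans (≤-reflexive (*-identityˡ _)) (r⁅⁆≤1 i))))
    with C , C-basis , eq ← rk-attained B
    = B , subst IsBasis C≡B C-basis , refl
    where
    ∣B∣≤ : ∣ B ∣ ℕ.≤ ∣ B ∩ C ∣
    ∣B∣≤ = begin
      ∣ B ∣        ≡⟨ cong ∣_∣ (∩-idem B) ⟨
      ∣ B ∩ B ∣    ≤⟨ drop‿+≤+ (subst₂ _≤_ (ev-indicator B B) (*-identityˡ _) (upper B)) ⟩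
      rk M B       ≡⟨ eq ⟩
      ∣ B ∩ C ∣    ∎
      where open ℕ.≤-Reasoning
    B∩C≡B : B ∩ C ≡ B
    B∩C≡B = ∣p∣≤∣p∩q∣⇒p∩q≡p B C ∣B∣≤
    ∣C∣≤ : ∣ C ∣ ℕ.≤ ∣ C ∩ B ∣
    ∣C∣≤ = begin
      ∣ C ∣        ≡⟨ ∣⊤∩∣ C ⟨
      ∣ ⊤ ∩ C ∣    ≤⟨ rk-upper ⊤ C-basis ⟩
      rk M ⊤       ≤⟨ drop‿+≤+ (subst₂ _≤_ (*-identityˡ _) (ev-indicator B ⊤) top) ⟩
      ∣ ⊤ ∩ B ∣    ≡⟨ ∣⊤∩∣ B ⟩
      ∣ B ∣        ≤⟨ ∣B∣≤ ⟩
      ∣ B ∩ C ∣    ≡⟨ cong ∣_∣ (∩-comm B C) ⟩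
      ∣ C ∩ B ∣    ∎
      where open ℕ.≤-Reasoning
    C≡B : C ≡ B
    C≡B = trans (sym (∣p∣≤∣p∩q∣⇒p∩q≡p C B ∣C∣≤)) (trans (∩-comm C B) B∩C≡B)

  private
    excess : ℕ → Vec ℤ (size E) → Subset (size E) → ℤ
    excess N z S = ev z S - + N * r S

    excess-supermodular : ∀ N z → Supermodular (excess N z)
    excess-supermodular N z X Y =
      lin₁ (l (ev z X) (ev z Y) (ev z (X ∪ Y)) (ev z (X ∩ Y)) (+ N)
          (r X) (r Y) (r (X ∪ Y)) (r (X ∩ Y)) (ev-∪-∩ z X Y))
        (*-monoˡ-≤-nonNeg (+ N) (r-submodular X Y))
      where
      l : ∀ a b u i n x y w v → u + i ≡ a + b →
          (u - n * w) + (i - n * v) - ((a - n * x) + (b - n * y)) ≡ n * (x + y) - n * (w + v)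
      l a b u i n x y w v eq = trans (l₁ a b u i n x y w v)
        (trans (cong (λ t → t - (a + b) + (n * (x + y) - n * (w + v))) eq) (l₂ a b n x y w v))
        where
        l₁ : ∀ a b u i n x y w v →
          (u - n * w) + (i - n * v) - ((a - n * x) + (b - n * y)) ≡
          u + i - (a + b) + (n * (x + y) - n * (w + v))
        l₁ = solve-∀
        l₂ : ∀ a b n x y w v →
          a + b - (a + b) + (n * (x + y) - n * (w + v)) ≡ n * (x + y) - n * (w + v)
        l₂ = solve-∀

    -r-supermodular : Supermodular (λ S → - r S)
    -r-supermodular X Y =
      lin₁ (l (r X) (r Y) (r (X ∪ Y)) (r (X ∩ Y))) (r-submodular X Y)
      where
      l : ∀ x y u i → - u + - i - (- x + - y) ≡ x + y - (u + i)
      l = solve-∀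

    excess≤r : ∀ N z S → ev z S ≤ + suc N * r S → excess N z S + - r S ≤ 0ℤ
    excess≤r N z S = lin₁ (l (ev z S) (+ N) (r S))
      where
      l : ∀ s n r → 0ℤ - (s - n * r + - r) ≡ (1ℤ + n) * r - s
      l = solve-∀

  -- By the sandwich theorem there is an integer vector m with
  -- z(S) - N r(S) ≤ m(S) ≤ r(S) for all S; it is a basis, and z - m lies in
  -- N · P(M).
  peel : ∀ N z → InBase (suc N) z →
         ∃ λ B → IsBasis B × InBase N (z ⊖ indicator B)
  peel N z (upper , top) =
    let d , m , bounds = sandwich (excess N z) (λ S → - r S)
          (excess-supermodular N z) -r-supermodular (λ S → excess≤r N z S (upper S))
    in split d m bounds
    where
    module _ (d : ℤ) (m : Vec ℤ (size E))
             (bounds : ∀ S → excess N z S ≤ d + ev m S × - r S ≤ - (d + ev m S)) where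
      -- Both functions of the sandwich vanish at the empty set, which forces the constant term to
      -- be zero.
      d≡0 : d ≡ 0ℤ
      d≡0 = ≤-antisym
        (subst₂ _≤_ (trans (cong (_+_ d) (ev-⊥ m)) (+-identityʳ d)) (cong +_ rk-⊥)
          (neg-cancel-≤ (proj₂ (bounds ⊥))))
        (subst₂ _≤_
          (cong₂ (λ v ρ → v - ρ) (ev-⊥ z)
            (trans (cong (λ ρ → + N * + ρ) rk-⊥) (*-zeroʳ (+ N))))
          (trans (cong (_+_ d) (ev-⊥ m)) (+-identityʳ d))
          (proj₁ (bounds ⊥)))
      d+ : ∀ S → d + ev m S ≡ ev m S
      d+ S = trans (cong (_+ ev m S) d≡0) (+-identityˡ _)
      m≤r : ∀ S → ev m S ≤ r S
      m≤r S = subst (_≤ r S) (d+ S) (neg-cancel-≤ (proj₂ (bounds S)))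
      excess≤m : ∀ S → excess N z S ≤ ev m S
      excess≤m S = subst (excess N z S ≤_) (d+ S) (proj₁ (bounds S))
      below : ∀ S → ev m S ≤ + 1 * r S
      below S = subst (ev m S ≤_) (sym (*-identityˡ (r S))) (m≤r S)
      above : + 1 * r ⊤ ≤ ev m ⊤
      above = lin₂ (l′ (+ N) (r ⊤) (ev m ⊤) (ev z ⊤)) (excess≤m ⊤) top
        where
        l′ : ∀ n r m z → m - 1ℤ * r ≡ (m - (z - n * r)) + (z - (1ℤ + n) * r)
        l′ = solve-∀
      rest-below : ∀ S → ev (z ⊖ m) S ≤ + N * r S
      rest-below S = subst (_≤ + N * r S) (sym (ev-⊖ z m S))
        (lin₁ (l′ (ev z S) (ev m S) (+ N * r S)) (excess≤m S))
        where
        l′ : ∀ z m n → n - (z - m) ≡ m - (z - n)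
        l′ = solve-∀
      rest-top : + N * r ⊤ ≤ ev (z ⊖ m) ⊤
      rest-top = subst (+ N * r ⊤ ≤_) (sym (ev-⊖ z m ⊤))
        (lin₂ (l′ (+ N) (r ⊤) (ev m ⊤) (ev z ⊤)) (m≤r ⊤) top)
        where
        l′ : ∀ n r m z → (z - m) - n * r ≡ (r - m) + (z - (1ℤ + n) * r)
        l′ = solve-∀

      split : ∃ λ B → IsBasis B × InBase N (z ⊖ indicator B)
      split = let B , B-basis , eq = basis-of-vector m (below , above)
              in B , B-basis , subst (λ v → InBase N (z ⊖ v)) eq (rest-below , rest-top)

  decompose : ∀ N z → InBase N z →
    ∃ λ (B : Fin N → ∃ IsBasis) →
      ∀ i → lookup z i ≡ ∑ (λ j → lookup (indicator (proj₁ (B j))) i)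
  -- In the 0-fold dilate the upper bounds and nonnegativity squeeze every coordinate to zero, the
  -- value of the empty sum.
  decompose zero    z z∈@(upper , _) = (λ ()) , λ i → trans (sym (ev-⁅⁆ z i))
    (≤-antisym (upper ⁅ i ⁆) (inBase-nonneg 0 {z} z∈ ⁅ i ⁆))
  decompose (suc N) z z∈ =
    let B , B-basis , rest∈ = peel N z z∈
        Bs , eqs = decompose N (z ⊖ indicator B) rest∈
    in (λ where zero → B , B-basis ; (suc j) → Bs j) , λ i →
       trans (lookup-⊖ z (indicator B) i) (cong (_+_ (lookup (indicator B) i)) (eqs i))

-- Rational points of real convex hulls

-- The denominator 1 is written out explicitly, so order and arithmetic on these rationals reduce to
-- the numerators by unfolding.
ι : ℤ → ℚ
ι z = mkℚ z 0 (Coprimality.sym (Coprimality.1-coprimeTo ℤ.∣ z ∣))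

ι-+ : ∀ a b → ι (a + b) ≡ ι a ℚ.+ ι b
ι-+ a b = ℚ.toℚᵘ-injective
  (ℚᵘ.≃-sym (ℚᵘ.≃-trans (ℚ.toℚᵘ-homo-+ (ι a) (ι b)) (*≡* (l a b))))
  where
  l : ∀ a b → (a * 1ℤ + b * 1ℤ) * 1ℤ ≡ (a + b) * 1ℤ
  l = solve-∀

ι-* : ∀ a b → ι (a * b) ≡ ι a ℚ.* ι b
ι-* a b = ℚ.toℚᵘ-injective (ℚᵘ.≃-sym (ℚ.toℚᵘ-homo-* (ι a) (ι b)))

ι-mono-≤ : ∀ {a b} → a ≤ b → ι a ℚ.≤ ι b
ι-mono-≤ {a} {b} a≤b =
  *≤* (subst₂ _≤_ (sym (*-identityʳ a)) (sym (*-identityʳ b)) a≤b)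

ι-cancel-≤ : ∀ {a b} → ι a ℚ.≤ ι b → a ≤ b
ι-cancel-≤ {a} {b} (*≤* a≤b) = subst₂ _≤_ (*-identityʳ a) (*-identityʳ b) a≤b

ι-pos : ∀ N → .{{ℕ.NonZero N}} → ℚ.Positive (ι (+ N))
ι-pos (suc N) = _

∑ℚ-difference : ∀ {m} (f g : Vector ℚ m) → ∑ℚ (λ k → f k ℚ.- g k) ≡ ∑ℚ f ℚ.- ∑ℚ g
∑ℚ-difference {zero}  f g = refl
∑ℚ-difference {suc m} f g =
  trans (cong (ℚ._+_ (f zero ℚ.- g zero)) (∑ℚ-difference (f ∘ suc) (g ∘ suc)))
        (l (f zero) (g zero) (∑ℚ (f ∘ suc)) (∑ℚ (g ∘ suc)))
  where
  l : ∀ a b c d → (a ℚ.- b) ℚ.+ (c ℚ.- d) ≡ (a ℚ.+ c) ℚ.- (b ℚ.+ d)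
  l = solve 4 (λ a b c d → (a :- b) :+ (c :- d) := (a :+ c) :- (b :+ d)) refl
    where open +-*-Solver

seq-∑ᵣ : ∀ {m} (w : Vector ℝ m) t → seq (∑ᵣ w) t ≡ ∑ℚ (λ k → seq (w k) t)
seq-∑ᵣ {zero}  w t = refl
seq-∑ᵣ {suc m} w t = cong (ℚ._+_ (seq (w zero) t)) (seq-∑ᵣ (w ∘ suc) t)

-- liminf a ≥ 0
record EventuallyNonneg (a : ℕ → ℚ) : Set where
  constructor eventually
  field
    nonneg : ∀ ε → 0ℚ ℚ.< ε → ∃ λ N → ∀ t → N ℕ.≤ t → 0ℚ ℚ.≤ a t ℚ.+ ε

open EventuallyNonneg

Null : (ℕ → ℚ) → Set
Null a = ∀ ε → 0ℚ ℚ.< ε → ∃ λ N → ∀ t → N ℕ.≤ t → ℚ.∣ a t ∣ ℚ.< ε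

eventuallyNonneg-cong : ∀ {a b : ℕ → ℚ} → (∀ t → a t ≡ b t) →
                        EventuallyNonneg a → EventuallyNonneg b
eventuallyNonneg-cong eq a≥0 = eventually λ ε 0<ε → let N , bound = nonneg a≥0 ε 0<ε in
  N , λ t N≤t → subst (λ v → 0ℚ ℚ.≤ v ℚ.+ ε) (eq t) (bound t N≤t)

eventuallyNonneg-+ : ∀ {a b : ℕ → ℚ} → EventuallyNonneg a → EventuallyNonneg b →
                     EventuallyNonneg (λ t → a t ℚ.+ b t)
nonneg (eventuallyNonneg-+ {a} {b} a≥0 b≥0) ε 0<ε =
  let N₁ , bound₁ = nonneg a≥0 (½ ℚ.* ε) 0<½ε
      N₂ , bound₂ = nonneg b≥0 (½ ℚ.* ε) 0<½ε
  in N₁ ℕ.⊔ N₂ , λ t N≤t → subst (0ℚ ℚ.≤_)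
       (trans (l (a t) (b t) (½ ℚ.* ε)) (cong (ℚ._+_ (a t ℚ.+ b t)) ½ε+½ε))
       (ℚ.+-mono-≤ (bound₁ t (ℕ.m⊔n≤o⇒m≤o N₁ N₂ N≤t)) (bound₂ t (ℕ.m⊔n≤o⇒n≤o N₁ N₂ N≤t)))
  where
  0<½ε : 0ℚ ℚ.< ½ ℚ.* ε
  0<½ε = subst (ℚ._< ½ ℚ.* ε) (ℚ.*-zeroʳ ½) (ℚ.*-monoʳ-<-pos ½ 0<ε)
  ½ε+½ε : ½ ℚ.* ε ℚ.+ ½ ℚ.* ε ≡ ε
  ½ε+½ε = trans (sym (ℚ.*-distribʳ-+ ε ½ ½)) (ℚ.*-identityˡ ε)
  l : ∀ x y h → (x ℚ.+ h) ℚ.+ (y ℚ.+ h) ≡ (x ℚ.+ y) ℚ.+ (h ℚ.+ h)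
  l = solve 3 (λ x y h → (x :+ h) :+ (y :+ h) := (x :+ y) :+ (h :+ h)) refl
    where open +-*-Solver

eventuallyNonneg-const : ∀ {c} → 0ℚ ℚ.≤ c → EventuallyNonneg (λ _ → c)
eventuallyNonneg-const 0≤c = eventually λ ε 0<ε → 0 , λ _ _ → ℚ.+-mono-≤ 0≤c (ℚ.<⇒≤ 0<ε)

eventuallyNonneg-∑ : ∀ {m} {a : Fin m → ℕ → ℚ} → (∀ k → EventuallyNonneg (a k)) →
                     EventuallyNonneg (λ t → ∑ℚ (λ k → a k t))
eventuallyNonneg-∑ {zero}  a≥0 = eventuallyNonneg-const ℚ.≤-refl
eventuallyNonneg-∑ {suc m} a≥0 =
  eventuallyNonneg-+ (a≥0 zero) (eventuallyNonneg-∑ (a≥0 ∘ suc))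

eventuallyNonneg-* : ∀ {c} {a : ℕ → ℚ} → 0ℚ ℚ.≤ c → EventuallyNonneg a →
                     EventuallyNonneg (λ t → c ℚ.* a t)
nonneg (eventuallyNonneg-* {c} {a} 0≤c a≥0) ε 0<ε =
  let N , bound = nonneg a≥0 δ 0<δ
  in N , λ t N≤t → begin
    0ℚ                          ≡⟨ ℚ.*-zeroʳ c ⟨
    c ℚ.* 0ℚ                    ≤⟨ ℚ.*-monoˡ-≤-nonNeg c {{ℚ.nonNegative 0≤c}} (bound t N≤t) ⟩
    c ℚ.* (a t ℚ.+ δ)           ≡⟨ ℚ.*-distribˡ-+ c (a t) δ ⟩
    c ℚ.* a t ℚ.+ c ℚ.* δ       ≤⟨ ℚ.+-monoʳ-≤ (c ℚ.* a t) cδ≤ε ⟩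
    c ℚ.* a t ℚ.+ ε             ∎
  where
  open ℚ.≤-Reasoning
  0<c+1 : 0ℚ ℚ.< c ℚ.+ 1ℚ
  0<c+1 = ℚ.+-mono-≤-< 0≤c (ℚ.positive⁻¹ 1ℚ)
  instance
    c+1-pos : ℚ.Positive (c ℚ.+ 1ℚ)
    c+1-pos = ℚ.positive 0<c+1
    c+1≢0 : ℚ.NonZero (c ℚ.+ 1ℚ)
    c+1≢0 = ℚ.pos⇒nonZero (c ℚ.+ 1ℚ)
  δ : ℚ
  δ = ℚ.1/ (c ℚ.+ 1ℚ) ℚ.* ε
  0<δ : 0ℚ ℚ.< δ
  0<δ = subst (ℚ._< δ) (ℚ.*-zeroʳ (ℚ.1/ (c ℚ.+ 1ℚ)))
          (ℚ.*-monoʳ-<-pos (ℚ.1/ (c ℚ.+ 1ℚ)) {{ℚ.1/pos⇒pos (c ℚ.+ 1ℚ)}} 0<ε)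
  cδ≤ε : c ℚ.* δ ℚ.≤ ε
  cδ≤ε = begin
    c ℚ.* δ                             ≡⟨ ℚ.+-identityʳ (c ℚ.* δ) ⟨
    c ℚ.* δ ℚ.+ 0ℚ                      ≤⟨ ℚ.+-monoʳ-≤ (c ℚ.* δ) (ℚ.<⇒≤ 0<δ) ⟩
    c ℚ.* δ ℚ.+ δ                       ≡⟨ cong (ℚ._+_ (c ℚ.* δ)) (ℚ.*-identityˡ δ) ⟨
    c ℚ.* δ ℚ.+ 1ℚ ℚ.* δ                ≡⟨ ℚ.*-distribʳ-+ δ c 1ℚ ⟨
    (c ℚ.+ 1ℚ) ℚ.* δ                    ≡⟨ ℚ.*-assoc (c ℚ.+ 1ℚ) _ ε ⟨
    (c ℚ.+ 1ℚ) ℚ.* ℚ.1/ (c ℚ.+ 1ℚ) ℚ.* ε ≡⟨ cong (ℚ._* ε) (ℚ.*-inverseʳ (c ℚ.+ 1ℚ)) ⟩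
    1ℚ ℚ.* ε                            ≡⟨ ℚ.*-identityˡ ε ⟩
    ε                                   ∎

null⇒eventuallyNonneg : ∀ {a : ℕ → ℚ} → Null a → EventuallyNonneg a
nonneg (null⇒eventuallyNonneg {a} a→0) ε 0<ε = let N , bound = a→0 ε 0<ε in
  N , λ t N≤t → begin
    0ℚ                          ≡⟨ ℚ.+-inverseʳ (a t) ⟨
    a t ℚ.+ ℚ.- a t             ≤⟨ ℚ.+-monoʳ-≤ (a t) (ℚ.≤-trans (p≤∣p∣ (ℚ.- a t))
                                     (ℚ.≤-reflexive (ℚ.∣-p∣≡∣p∣ (a t)))) ⟩
    a t ℚ.+ ℚ.∣ a t ∣           ≤⟨ ℚ.+-monoʳ-≤ (a t) (ℚ.<⇒≤ (bound t N≤t)) ⟩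
    a t ℚ.+ ε                   ∎
  where
  open ℚ.≤-Reasoning
  p≤∣p∣ : ∀ p → p ℚ.≤ ℚ.∣ p ∣
  p≤∣p∣ p with ℚ.≤-total 0ℚ p
  ... | inj₁ 0≤p = ℚ.≤-reflexive (sym (ℚ.0≤p⇒∣p∣≡p 0≤p))
  ... | inj₂ p≤0 = ℚ.≤-trans p≤0 (ℚ.0≤∣p∣ p)

null-neg : ∀ {a : ℕ → ℚ} → Null a → Null (λ t → ℚ.- a t)
null-neg {a} a→0 ε 0<ε = let N , bound = a→0 ε 0<ε in
  N , λ t N≤t → subst (ℚ._< ε) (sym (ℚ.∣-p∣≡∣p∣ (a t))) (bound t N≤t)

null-* : ∀ c {a : ℕ → ℚ} → Null a → EventuallyNonneg (λ t → c ℚ.* a t)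
null-* c {a} a→0 with ℚ.≤-total 0ℚ c
... | inj₁ 0≤c = eventuallyNonneg-* 0≤c (null⇒eventuallyNonneg a→0)
... | inj₂ c≤0 = eventuallyNonneg-cong (λ t → l c (a t))
  (eventuallyNonneg-* (ℚ.neg-antimono-≤ c≤0) (null⇒eventuallyNonneg (null-neg {a} a→0)))
  where
  l : ∀ c x → ℚ.- c ℚ.* ℚ.- x ≡ c ℚ.* x
  l = solve 2 (λ c x → :- c :* :- x := c :* x) refl
    where open +-*-Solver

eventuallyNonneg-const⁻¹ : ∀ {c} → EventuallyNonneg (λ _ → c) → 0ℚ ℚ.≤ c
eventuallyNonneg-const⁻¹ {c} c≥0 = ℚ.≮⇒≥ λ c<0 →
  let 0<-c = ℚ.neg-antimono-< c<0
      0<ε = subst (ℚ._< ½ ℚ.* ℚ.- c) (ℚ.*-zeroʳ ½) (ℚ.*-monoʳ-<-pos ½ 0<-c)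
      N , bound = nonneg c≥0 (½ ℚ.* ℚ.- c) 0<ε
  in ℚ.<-irrefl refl (ℚ.<-≤-trans
       (subst₂ ℚ._<_ (halve c) (ℚ.*-zeroʳ ½) (ℚ.*-monoʳ-<-pos ½ c<0)) (bound N ℕ.≤-refl))
  where
  open +-*-Solver
  halve : ∀ c → ½ ℚ.* c ≡ c ℚ.+ ½ ℚ.* ℚ.- c
  halve = solve 1 (λ c → con ½ :* c := c :+ con ½ :* :- c) refl

-- The weights are real, so at a finite stage their approximants may be slightly negative, need not
-- sum to 1 and only nearly represent q. These defects vanish in the limit, while ρ minus the value
-- of the functional at q is a constant, and a constant with nonnegative limit inferior is
-- nonnegative.
conv-⊆-halfspace : {I : Set} (p : I → Vector ℝ n) (P : I → Vector ℚ n) →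
  (∀ j i t → seq (p j i) t ≡ P j i) →
  ∀ (s : Vector ℚ n) ρ → (∀ j → ∑ℚ (λ i → s i ℚ.* P j i) ℚ.≤ ρ) →
  ∀ (q : Vector ℚ n) → conv p (fromℚ ∘ q) → ∑ℚ (λ i → s i ℚ.* q i) ℚ.≤ ρ
conv-⊆-halfspace {n} p P p≡P s ρ p∈ q (m , j , w , 0≤w , ∑w≈1 , q≈) =
  0≤b-a⇒a≤b (eventuallyNonneg-const⁻¹ (eventuallyNonneg-cong identity
    (eventuallyNonneg-+ (eventuallyNonneg-∑ slack)
      (eventuallyNonneg-+ (null-* (ℚ.- ρ) ∑w→1)
        (eventuallyNonneg-∑ λ i → null-* (ℚ.- s i) (q→ i))))))
  where
  0≤b-a⇒a≤b : ∀ {a b} → 0ℚ ℚ.≤ b ℚ.- a → a ℚ.≤ b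
  0≤b-a⇒a≤b {a} {b} 0≤ = subst₂ ℚ._≤_ (ℚ.+-identityʳ a) (l a b) (ℚ.+-monoʳ-≤ a 0≤)
    where
    l : ∀ a b → a ℚ.+ (b ℚ.- a) ≡ b
    l = solve 2 (λ a b → a :+ (b :- a) := b) refl
      where open +-*-Solver
  a≤b⇒0≤b-a : ∀ {a b} → a ℚ.≤ b → 0ℚ ℚ.≤ b ℚ.- a
  a≤b⇒0≤b-a {a} {b} a≤b = subst (ℚ._≤ b ℚ.- a) (ℚ.+-inverseʳ a) (ℚ.+-monoˡ-≤ (ℚ.- a) a≤b)
  D : Vector ℚ m
  D k = ∑ℚ (λ i → s i ℚ.* P (j k) i)
  W : ℕ → Vector ℚ m
  W t k = seq (w k) t
  Y : ℕ → Vector ℚ n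
  Y t i = ∑ℚ (λ k → W t k ℚ.* P (j k) i)
  slack : ∀ k → EventuallyNonneg (λ t → (ρ ℚ.- D k) ℚ.* W t k)
  slack k = eventuallyNonneg-* (a≤b⇒0≤b-a (p∈ (j k))) (eventually (0≤w k))
  ∑w→1 : Null (λ t → ∑ℚ (W t) ℚ.- 1ℚ)
  ∑w→1 ε 0<ε = let N , bound = ∑w≈1 ε 0<ε in
    N , λ t N≤t → subst (λ v → ℚ.∣ v ℚ.- 1ℚ ∣ ℚ.< ε) (seq-∑ᵣ w t) (bound t N≤t)
  q→ : ∀ i → Null (λ t → q i ℚ.- Y t i)
  q→ i ε 0<ε = let N , bound = q≈ i ε 0<ε in
    N , λ t N≤t → subst (λ v → ℚ.∣ q i ℚ.- v ∣ ℚ.< ε)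
      (trans (seq-∑ᵣ (λ k → w k *ᵣ p (j k) i) t)
        (∑ℚ.sum-cong-≗ λ k → cong (ℚ._*_ (W t k)) (p≡P (j k) i t)))
      (bound t N≤t)
  swap : ∀ t → ∑ℚ (λ i → s i ℚ.* Y t i) ≡ ∑ℚ (λ k → D k ℚ.* W t k)
  swap t = begin
    ∑ℚ (λ i → s i ℚ.* Y t i)
      ≡⟨ ∑ℚ.sum-cong-≗ (λ i → ∑ℚ.*-distribˡ-sum (s i) (λ k → W t k ℚ.* P (j k) i)) ⟩
    ∑ℚ (λ i → ∑ℚ (λ k → s i ℚ.* (W t k ℚ.* P (j k) i)))
      ≡⟨ ∑ℚ.∑-comm (λ i k → s i ℚ.* (W t k ℚ.* P (j k) i)) ⟩
    ∑ℚ (λ k → ∑ℚ (λ i → s i ℚ.* (W t k ℚ.* P (j k) i)))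
      ≡⟨ ∑ℚ.sum-cong-≗ (λ k → ∑ℚ.sum-cong-≗ λ i → l (s i) (W t k) (P (j k) i)) ⟩
    ∑ℚ (λ k → ∑ℚ (λ i → s i ℚ.* P (j k) i ℚ.* W t k))
      ≡⟨ ∑ℚ.sum-cong-≗ (λ k → ∑ℚ.*-distribʳ-sum (W t k) (λ i → s i ℚ.* P (j k) i)) ⟨
    ∑ℚ (λ k → D k ℚ.* W t k) ∎
    where
    open ≡-Reasoning
    l : ∀ a b c → a ℚ.* (b ℚ.* c) ≡ a ℚ.* c ℚ.* b
    l = solve 3 (λ a b c → a :* (b :* c) := a :* c :* b) refl
      where open +-*-Solver
  -- This holds exactly at each stage t: the slacks of the chosen points plus two error terms that
  -- tend to zero add up to the slack of q.
  identity : ∀ t →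
    ∑ℚ (λ k → (ρ ℚ.- D k) ℚ.* W t k) ℚ.+
      (ℚ.- ρ ℚ.* (∑ℚ (W t) ℚ.- 1ℚ) ℚ.+ ∑ℚ (λ i → ℚ.- s i ℚ.* (q i ℚ.- Y t i)))
    ≡ ρ ℚ.- ∑ℚ (λ i → s i ℚ.* q i)
  identity t = begin
    ∑ℚ (λ k → (ρ ℚ.- D k) ℚ.* W t k) ℚ.+
      (ℚ.- ρ ℚ.* (∑ℚ (W t) ℚ.- 1ℚ) ℚ.+ ∑ℚ (λ i → ℚ.- s i ℚ.* (q i ℚ.- Y t i)))
      ≡⟨ cong₂ (λ a b → a ℚ.+ (ℚ.- ρ ℚ.* (∑ℚ (W t) ℚ.- 1ℚ) ℚ.+ b)) left right ⟩
    (ρ ℚ.* ∑ℚ (W t) ℚ.- C) ℚ.+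
      (ℚ.- ρ ℚ.* (∑ℚ (W t) ℚ.- 1ℚ) ℚ.+ (C ℚ.- ∑ℚ (λ i → s i ℚ.* q i)))
      ≡⟨ l ρ (∑ℚ (W t)) C (∑ℚ (λ i → s i ℚ.* q i)) ⟩
    ρ ℚ.- ∑ℚ (λ i → s i ℚ.* q i) ∎
    where
    open ≡-Reasoning
    C : ℚ
    C = ∑ℚ (λ k → D k ℚ.* W t k)
    l : ∀ ρ w c d → (ρ ℚ.* w ℚ.- c) ℚ.+ (ℚ.- ρ ℚ.* (w ℚ.- 1ℚ) ℚ.+ (c ℚ.- d)) ≡ ρ ℚ.- d
    l = solve 4 (λ ρ w c d → (ρ :* w :- c) :+ (:- ρ :* (w :- con 1ℚ) :+ (c :- d)) := ρ :- d) refl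
      where open +-*-Solver
    left : ∑ℚ (λ k → (ρ ℚ.- D k) ℚ.* W t k) ≡ ρ ℚ.* ∑ℚ (W t) ℚ.- C
    left = begin
      ∑ℚ (λ k → (ρ ℚ.- D k) ℚ.* W t k)                 ≡⟨ ∑ℚ.sum-cong-≗ (λ k → l′ ρ (D k) (W t k)) ⟩
      ∑ℚ (λ k → ρ ℚ.* W t k ℚ.- D k ℚ.* W t k)         ≡⟨ ∑ℚ-difference (λ k → ρ ℚ.* W t k) _ ⟩
      ∑ℚ (λ k → ρ ℚ.* W t k) ℚ.- C                     ≡⟨ cong (ℚ._- C) (∑ℚ.*-distribˡ-sum ρ (W t)) ⟨
      ρ ℚ.* ∑ℚ (W t) ℚ.- C                             ∎
      where
      l′ : ∀ a b c → (a ℚ.- b) ℚ.* c ≡ a ℚ.* c ℚ.- b ℚ.* c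
      l′ = solve 3 (λ a b c → (a :- b) :* c := a :* c :- b :* c) refl
        where open +-*-Solver
    right : ∑ℚ (λ i → ℚ.- s i ℚ.* (q i ℚ.- Y t i)) ≡ C ℚ.- ∑ℚ (λ i → s i ℚ.* q i)
    right = begin
      ∑ℚ (λ i → ℚ.- s i ℚ.* (q i ℚ.- Y t i))            ≡⟨ ∑ℚ.sum-cong-≗ (λ i → l′ (s i) (q i) (Y t i)) ⟩
      ∑ℚ (λ i → s i ℚ.* Y t i ℚ.- s i ℚ.* q i)          ≡⟨ ∑ℚ-difference (λ i → s i ℚ.* Y t i) _ ⟩
      ∑ℚ (λ i → s i ℚ.* Y t i) ℚ.- ∑ℚ (λ i → s i ℚ.* q i) ≡⟨ cong (ℚ._- ∑ℚ (λ i → s i ℚ.* q i)) (swap t) ⟩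
      C ℚ.- ∑ℚ (λ i → s i ℚ.* q i)                      ∎
      where
      l′ : ∀ a b c → ℚ.- a ℚ.* (b ℚ.- c) ≡ a ℚ.* c ℚ.- a ℚ.* b
      l′ = solve 3 (λ a b c → :- a :* (b :- c) := a :* c :- a :* b) refl
        where open +-*-Solver

∑ℚ-∙-indicator : ∀ (S : Subset k) (x : Vec ℤ k) →
  ∑ℚ (λ i → ι (lookup (indicator S) i) ℚ.* ι (lookup x i)) ≡ ι (ev x S)
∑ℚ-∙-indicator []            []      = refl
∑ℚ-∙-indicator (outside ∷ S) (a ∷ x) =
  trans (cong₂ ℚ._+_ (ℚ.*-zeroˡ (ι a)) (∑ℚ-∙-indicator S x)) (ℚ.+-identityˡ _)
∑ℚ-∙-indicator (inside ∷ S)  (a ∷ x) =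
  trans (cong₂ ℚ._+_ (ℚ.*-identityˡ (ι a)) (∑ℚ-∙-indicator S x)) (sym (ι-+ a (ev x S)))

∑ℚ-ι : ∀ u {m} (c : Vector ℤ m) → ∑ℚ (λ k → u ℚ.* ι (c k)) ≡ u ℚ.* ι (∑ c)
∑ℚ-ι u {zero}  c = sym (ℚ.*-zeroʳ u)
∑ℚ-ι u {suc m} c = begin
  u ℚ.* ι (c zero) ℚ.+ ∑ℚ (λ k → u ℚ.* ι (c (suc k)))
    ≡⟨ cong (ℚ._+_ (u ℚ.* ι (c zero))) (∑ℚ-ι u (c ∘ suc)) ⟩
  u ℚ.* ι (c zero) ℚ.+ u ℚ.* ι (∑ (c ∘ suc))
    ≡⟨ ℚ.*-distribˡ-+ u (ι (c zero)) (ι (∑ (c ∘ suc))) ⟨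
  u ℚ.* (ι (c zero) ℚ.+ ι (∑ (c ∘ suc)))
    ≡⟨ cong (ℚ._*_ u) (ι-+ (c zero) (∑ (c ∘ suc))) ⟨
  u ℚ.* ι (∑ c) ∎
  where open ≡-Reasoning

∑-ones : ∀ m → ∑ {m} (λ _ → 1ℤ) ≡ + m
∑-ones zero    = refl
∑-ones (suc m) = cong (_+_ 1ℤ) (∑-ones m)

seq-indicatorVector : ∀ (S : Subset k) i t →
                      seq (indicatorVector S i) t ≡ ι (lookup (indicator S) i)
seq-indicatorVector (outside ∷ S) zero    t = refl
seq-indicatorVector (inside ∷ S)  zero    t = refl
seq-indicatorVector (_ ∷ S)       (suc i) t = seq-indicatorVector S i t

seq≡⇒≈ᵣ : ∀ x y → (∀ t → seq x t ≡ seq y t) → x ≈ᵣ y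
seq≡⇒≈ᵣ x y eq ε 0<ε = 0 , λ t _ → subst (ℚ._< ε)
  (sym (cong ℚ.∣_∣ (trans (cong (λ v → v ℚ.- seq y t) (eq t)) (ℚ.+-inverseʳ (seq y t))))) 0<ε

module Scaled (N : ℕ) .{{_ : ℕ.NonZero N}} where

  instance
    N-pos : ℚ.Positive (ι (+ N))
    N-pos = ι-pos N
    N≢0 : ℚ.NonZero (ι (+ N))
    N≢0 = ℚ.pos⇒nonZero (ι (+ N))

  1/N : ℚ
  1/N = ℚ.1/ ι (+ N)

  point : Vec ℤ k → Vector ℚ k
  point z i = 1/N ℚ.* ι (lookup z i)

module Membership {E : GroundSet} (M : Matroid E) (N : ℕ) .{{N≢0 : ℕ.NonZero N}} where
  open Matroid M
  open Rank M
  open Decomposition M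
  open Scaled N {{N≢0}}

  private
    0<1/N : 0ℚ ℚ.< 1/N
    0<1/N = ℚ.positive⁻¹ 1/N {{ℚ.1/pos⇒pos (ι (+ N))}}

    module _ (B : Fin N → ∃ IsBasis) where
      summand : Fin (size E) → Vector ℝ N
      summand i j = fromℚ 1/N *ᵣ indicatorVector (proj₁ (B j)) i

      seq-∑-summand : ∀ i t →
        1/N ℚ.* ι (∑ (λ j → lookup (indicator (proj₁ (B j))) i)) ≡ seq (∑ᵣ (summand i)) t
      seq-∑-summand i t = begin
        1/N ℚ.* ι (∑ (λ j → lookup (indicator (proj₁ (B j))) i))
          ≡⟨ ∑ℚ-ι 1/N (λ j → lookup (indicator (proj₁ (B j))) i) ⟨
        ∑ℚ (λ j → 1/N ℚ.* ι (lookup (indicator (proj₁ (B j))) i))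
          ≡⟨ ∑ℚ.sum-cong-≗ (λ j → cong (ℚ._*_ 1/N) (seq-indicatorVector (proj₁ (B j)) i t)) ⟨
        ∑ℚ (λ j → seq (summand i j) t)
          ≡⟨ seq-∑ᵣ (summand i) t ⟨
        seq (∑ᵣ (summand i)) t ∎
        where open ≡-Reasoning

    seq-∑-weights : ∀ t → seq (∑ᵣ {N} (λ _ → fromℚ 1/N)) t ≡ 1ℚ
    seq-∑-weights t = begin
      seq (∑ᵣ {N} (λ _ → fromℚ 1/N)) t    ≡⟨ seq-∑ᵣ {N} (λ _ → fromℚ 1/N) t ⟩
      ∑ℚ {N} (λ _ → 1/N)                  ≡⟨ ∑ℚ.sum-cong-≗ {N} (λ _ → ℚ.*-identityʳ 1/N) ⟨
      ∑ℚ {N} (λ _ → 1/N ℚ.* ι 1ℤ)         ≡⟨ ∑ℚ-ι 1/N {N} (λ _ → 1ℤ) ⟩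
      1/N ℚ.* ι (∑ {N} (λ _ → 1ℤ))        ≡⟨ cong (λ c → 1/N ℚ.* ι c) (∑-ones N) ⟩
      1/N ℚ.* ι (+ N)                     ≡⟨ ℚ.*-inverseˡ (ι (+ N)) ⟩
      1ℚ                                  ∎
      where open ≡-Reasoning

  -- The N bases of the integer decomposition, each with weight 1/N, exhibit the point as a convex
  -- combination.
  inBase⇒∈ : ∀ {z} → InBase N z → basePolytope M (fromℚ ∘ point z)
  inBase⇒∈ {z} z∈ = let B , z≡ = decompose N z z∈ in
    N , B , (λ _ → fromℚ 1/N) , (λ _ ε 0<ε → 0 , λ _ _ → ℚ.<⇒≤ (ℚ.+-mono-< 0<1/N 0<ε)) ,
    seq≡⇒≈ᵣ (∑ᵣ (λ (_ : Fin N) → fromℚ 1/N)) 1ᵣ seq-∑-weights ,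
    λ i → seq≡⇒≈ᵣ (fromℚ (point z i)) (∑ᵣ (summand B i)) λ t →
      trans (cong (λ c → 1/N ℚ.* ι c) (z≡ i)) (seq-∑-summand B i t)

  private
    -- A bound at the vertices passes to the hull and is then cleared of the denominator N. The
    -- factor c serves as a sign: 1 for the rank inequalities, -1 for the lower bound on the total.
    halfspace : ∀ z → basePolytope M (fromℚ ∘ point z) → ∀ c S ρ →
      (∀ {B} → IsBasis B → c * ev (indicator B) S ≤ ρ) → c * ev z S ≤ + N * ρ
    halfspace z z∈ c S ρ bound = ι-cancel-≤ (begin
      ι (c * ev z S)                                      ≡⟨ scaled ⟨
      ι (+ N) ℚ.* ∑ℚ (λ i → s i ℚ.* point z i)
        ≤⟨ ℚ.*-monoˡ-≤-nonNeg (ι (+ N)) {{ℚ.pos⇒nonNeg (ι (+ N))}} half ⟩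
      ι (+ N) ℚ.* ι ρ                                     ≡⟨ ι-* (+ N) ρ ⟨
      ι (+ N * ρ)                                         ∎)
      where
      open ℚ.≤-Reasoning
      s : Vector ℚ (size E)
      s i = ι c ℚ.* ι (lookup (indicator S) i)
      ∙-s : ∀ x → ∑ℚ (λ i → s i ℚ.* ι (lookup x i)) ≡ ι (c * ev x S)
      ∙-s x = begin-equality
        ∑ℚ (λ i → s i ℚ.* ι (lookup x i))
          ≡⟨ ∑ℚ.sum-cong-≗ (λ i → ℚ.*-assoc (ι c) (ι (lookup (indicator S) i)) (ι (lookup x i))) ⟩
        ∑ℚ (λ i → ι c ℚ.* (ι (lookup (indicator S) i) ℚ.* ι (lookup x i)))
          ≡⟨ ∑ℚ.*-distribˡ-sum (ι c) (λ i → ι (lookup (indicator S) i) ℚ.* ι (lookup x i)) ⟨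
        ι c ℚ.* ∑ℚ (λ i → ι (lookup (indicator S) i) ℚ.* ι (lookup x i))
          ≡⟨ cong (ℚ._*_ (ι c)) (∑ℚ-∙-indicator S x) ⟩
        ι c ℚ.* ι (ev x S)
          ≡⟨ ι-* c (ev x S) ⟨
        ι (c * ev x S) ∎
      half : ∑ℚ (λ i → s i ℚ.* point z i) ℚ.≤ ι ρ
      half = conv-⊆-halfspace (indicatorVector ∘ proj₁) (λ B i → ι (lookup (indicator (proj₁ B)) i))
        (λ B → seq-indicatorVector (proj₁ B)) s (ι ρ)
        (λ (B , B-basis) → subst (ℚ._≤ ι ρ) (sym (∙-s (indicator B))) (ι-mono-≤ (bound B-basis)))
        (point z) z∈
      scaled : ι (+ N) ℚ.* ∑ℚ (λ i → s i ℚ.* point z i) ≡ ι (c * ev z S)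
      scaled = begin-equality
        ι (+ N) ℚ.* ∑ℚ (λ i → s i ℚ.* point z i)
          ≡⟨ ∑ℚ.*-distribˡ-sum (ι (+ N)) (λ i → s i ℚ.* point z i) ⟩
        ∑ℚ (λ i → ι (+ N) ℚ.* (s i ℚ.* point z i))
          ≡⟨ ∑ℚ.sum-cong-≗ (λ i → clear (s i) (ι (lookup z i))) ⟩
        ∑ℚ (λ i → s i ℚ.* ι (lookup z i))
          ≡⟨ ∙-s z ⟩
        ι (c * ev z S) ∎
        where
        l : ∀ n u s z → n ℚ.* (s ℚ.* (u ℚ.* z)) ≡ (n ℚ.* u) ℚ.* (s ℚ.* z)
        l = solve 4 (λ n u s z → n :* (s :* (u :* z)) := (n :* u) :* (s :* z)) refl
          where open +-*-Solver
        clear : ∀ s z → ι (+ N) ℚ.* (s ℚ.* (1/N ℚ.* z)) ≡ s ℚ.* z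
        clear s z = trans (l (ι (+ N)) 1/N s z)
          (trans (cong (ℚ._* (s ℚ.* z)) (ℚ.*-inverseʳ (ι (+ N)))) (ℚ.*-identityˡ _))

  ∈⇒inBase : ∀ {z} → basePolytope M (fromℚ ∘ point z) → InBase N z
  ∈⇒inBase {z} z∈ =
    (λ S → subst (_≤ + N * r S) (*-identityˡ _) (halfspace z z∈ 1ℤ S (r S) λ {B} B-basis →
      subst (_≤ r S) (sym (trans (*-identityˡ _) (ev-indicator B S)))
        (+≤+ (rk-upper S B-basis)))) ,
    neg-cancel-≤ (subst₂ _≤_ (-1*i≡-i (ev z ⊤)) (sym (neg-distribʳ-* (+ N) (r ⊤)))
      (halfspace z z∈ (- 1ℤ) ⊤ (- r ⊤) λ {B} B-basis →
        subst (_≤ - r ⊤) (sym (-1*i≡-i _))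
          (neg-mono-≤ (subst (r ⊤ ≤_) (sym (ev-indicator B ⊤)) (+≤+ (rk-⊤≤∣basis∣ B-basis))))))

-- Flats

allSubsets? : {P : Subset k → Set} → U.Decidable P → Dec (∀ S → P S)
allSubsets? P? with anySubset? (¬? ∘ P?)
... | yes (S , ¬p) = no λ p → ¬p (p S)
... | no  ¬∃¬      = yes λ S → decidable-stable (P? S) λ ¬p → ¬∃¬ (S , ¬p)

[_] : {P : Set} → Dec P → ℤ
[ P? ] = if does P? then 1ℤ else 0ℤ

[]-true : {P : Set} (P? : Dec P) → P → [ P? ] ≡ 1ℤ
[]-true P? p rewrite dec-true P? p = refl

[]-false : {P : Set} (P? : Dec P) → ¬ P → [ P? ] ≡ 0ℤ
[]-false P? ¬p rewrite dec-false P? ¬p = refl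

-- The alternating sum Σ_{T ⊇ F} (-1)^|T \ F| g(T).
∑⊇ : Subset k → (Subset k → ℤ) → ℤ
∑⊇ []            g = g []
∑⊇ (inside ∷ F)  g = ∑⊇ F (g ∘ (inside ∷_))
∑⊇ (outside ∷ F) g = ∑⊇ F (g ∘ (outside ∷_)) - ∑⊇ F (g ∘ (inside ∷_))

∑⊇-cong : ∀ (F : Subset k) {g h} → (∀ T → F ⊆ T → g T ≡ h T) → ∑⊇ F g ≡ ∑⊇ F h
∑⊇-cong []            g≡h = g≡h [] id
∑⊇-cong (inside ∷ F)  g≡h = ∑⊇-cong F λ T F⊆T → g≡h (inside ∷ T) (s⊆s F⊆T)
∑⊇-cong (outside ∷ F) g≡h = cong₂ _-_
  (∑⊇-cong F λ T F⊆T → g≡h (outside ∷ T) (s⊆s F⊆T))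
  (∑⊇-cong F λ T F⊆T → g≡h (inside ∷ T) (out⊆ F⊆T))

∑⊇-zero : ∀ (F : Subset k) {g} → (∀ T → F ⊆ T → g T ≡ 0ℤ) → ∑⊇ F g ≡ 0ℤ
∑⊇-zero []            g≡0 = g≡0 [] id
∑⊇-zero (inside ∷ F)  g≡0 = ∑⊇-zero F λ T F⊆T → g≡0 (inside ∷ T) (s⊆s F⊆T)
∑⊇-zero (outside ∷ F) g≡0 = cong₂ _-_
  (∑⊇-zero F λ T F⊆T → g≡0 (outside ∷ T) (s⊆s F⊆T))
  (∑⊇-zero F λ T F⊆T → g≡0 (inside ∷ T) (out⊆ F⊆T))

-- Sign-reversing pairing of T with T ∪ ⁅ e ⁆.
∑⊇-cancel : ∀ (F : Subset k) {g e} → e ∉ F →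
            (∀ T → F ⊆ T → g (T ∪ ⁅ e ⁆) ≡ g T) → ∑⊇ F g ≡ 0ℤ
∑⊇-cancel (inside ∷ F)  {e = zero}  e∉ _   = contradiction here e∉
∑⊇-cancel (inside ∷ F)  {e = suc e} e∉ g-e =
  ∑⊇-cancel F (e∉ ∘ there) λ T F⊆T → g-e (inside ∷ T) (s⊆s F⊆T)
∑⊇-cancel (outside ∷ F) {g} {zero}  e∉ g-e = i≡j⇒i-j≡0 (∑⊇-cong F λ T F⊆T →
  trans (sym (g-e (outside ∷ T) (s⊆s F⊆T))) (cong (λ U → g (inside ∷ U)) (∪-identityʳ T)))
∑⊇-cancel (outside ∷ F) {e = suc e} e∉ g-e = cong₂ _-_
  (∑⊇-cancel F (e∉ ∘ there) λ T F⊆T → g-e (outside ∷ T) (s⊆s F⊆T))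
  (∑⊇-cancel F (e∉ ∘ there) λ T F⊆T → g-e (inside ∷ T) (out⊆ F⊆T))

∑⊇-head : ∀ (F : Subset k) {g} →
          (∀ T → F ⊆ T → ∀ {e} → e ∉ F → e ∈ T → g T ≡ 0ℤ) → ∑⊇ F g ≡ g F
∑⊇-head []            _   = refl
∑⊇-head (inside ∷ F)  g≡0 = ∑⊇-head F λ T F⊆T e∉F e∈T →
  g≡0 (inside ∷ T) (s⊆s F⊆T) (e∉F ∘ drop-there) (there e∈T)
∑⊇-head (outside ∷ F) g≡0 = trans
  (cong₂ _-_
    (∑⊇-head F λ T F⊆T e∉F e∈T →
      g≡0 (outside ∷ T) (s⊆s F⊆T) (e∉F ∘ drop-there) (there e∈T))
    (∑⊇-zero F λ T F⊆T → g≡0 (inside ∷ T) (out⊆ F⊆T) {zero} (λ ()) here))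
  (+-identityʳ _)

module Flats {E : GroundSet} (M : Matroid E) where
  open Matroid M
  open Rank M
  open Decomposition M

  inBase? : ∀ N → U.Decidable (InBase N)
  inBase? N z = allSubsets? (λ S → ev z S ≤? + N * r S) ×-dec (+ N * r ⊤ ≤? ev z ⊤)

  -- The denominator belongs to the finest grid, on which the first eliminated coordinate lives; the
  -- other coordinates have been doubled up to it.
  polytopeIndicator : Vec ℤ (size E) → ℤ
  polytopeIndicator z = [ inBase? (2^ size E) z ]

  inBase⇔inPolytope : ∀ N z → InBase N z ⇔ InPolytope N (truncate (r ⊤) (λ _ → 0ℤ) r) r z
  inBase⇔inPolytope N z = mk⇔
    (λ z∈ → truncate-complete r-paramodular (r ⊤) N z
      (λ S → subst (_≤ ev z S) (sym (*-zeroʳ (+ N))) (inBase-nonneg N {z} z∈ S) , proj₁ z∈ S)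
      (proj₂ z∈))
    (λ z∈ → let z∈′ , top = truncate-sound r-paramodular (r ⊤) N z z∈
      in proj₂ ∘ z∈′ , top)

  chainIndicator : (F T : Subset (size E)) → (i j : ℕ) → ℤ
  chainIndicator F T i j = χ (boundPlan₂ F T (+ i) (+ j)) polytopeIndicator

  private
    indicates : Indicates polytopeIndicator
                  (InPolytope (2^ size E) (truncate (r ⊤) (λ _ → 0ℤ) r) r)
    indicates =
      (λ z z∈ → []-true (inBase? (2^ size E) z)
        (Equivalence.from (inBase⇔inPolytope (2^ size E) z) z∈)) ,
      (λ z z∉ → []-false (inBase? (2^ size E) z)
        (z∉ ∘ Equivalence.to (inBase⇔inPolytope (2^ size E) z)))

  -- The plan depends on F, T, i and j only. The matroid enters through the function that is summed,
  -- and the two guards compare j with the rank of T and i with the rank of F.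
  chainIndicator-≡ : ∀ {F T} → F ⊆ T → ∀ i j →
    chainIndicator F T i j ≡ [ (j ℕ.≤? rk M T) ×-dec (i ℕ.≤? rk M F) ]
  chainIndicator-≡ {F} {T} F⊆T i j = helper ((j ℕ.≤? rk M T) ×-dec (i ℕ.≤? rk M F))
    where
    plan : Plan (size E)
    plan = boundPlan₂ F T (+ i) (+ j)
    admits : Admits plan r ⇔ (+ j ≤ r T × + i ≤ r F)
    admits = admits-boundPlan₂ F T F⊆T (+ i) (+ j) r
    χ-value : (Admits plan r → χ plan polytopeIndicator ≡ 1ℤ) ×
              (¬ Admits plan r → χ plan polytopeIndicator ≡ 0ℤ)
    χ-value = χ-indicates plan (truncate-paramodular r-paramodular (r ⊤) ≤-refl) indicates
    helper : (d : Dec (j ℕ.≤ rk M T × i ℕ.≤ rk M F)) → χ plan polytopeIndicator ≡ [ d ]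
    helper (yes (j≤ , i≤)) = proj₁ χ-value (Equivalence.from admits (+≤+ j≤ , +≤+ i≤))
    helper (no ¬chain)     = proj₂ χ-value λ adm →
      let j≤ , i≤ = Equivalence.to admits adm in ¬chain (drop‿+≤+ j≤ , drop‿+≤+ i≤)

  levelIndicator : ℕ → (F T : Subset (size E)) → ℤ
  levelIndicator t F T = chainIndicator F T t t - chainIndicator F T t (suc t)

  -- The difference keeps the case rk F ≥ t and rk T = t, and monotonicity of the rank then forces
  -- rk F = t as well.
  levelIndicator-≡ : ∀ t {F T} → F ⊆ T →
    levelIndicator t F T ≡ [ (rk M F ℕ.≟ t) ×-dec (rk M T ℕ.≟ t) ]
  levelIndicator-≡ t {F} {T} F⊆T = trans
    (cong₂ _-_ (chainIndicator-≡ F⊆T t t) (chainIndicator-≡ F⊆T t (suc t)))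
    (cases (rk-mono F⊆T))
    where
    cases : ∀ {f u} → f ℕ.≤ u →
      [ (t ℕ.≤? u) ×-dec (t ℕ.≤? f) ] - [ (suc t ℕ.≤? u) ×-dec (t ℕ.≤? f) ] ≡
      [ (f ℕ.≟ t) ×-dec (u ℕ.≟ t) ]
    cases {f} {u} f≤u = by-value (t ℕ.≤? f) (suc t ℕ.≤? u)
      where
      by-value : Dec (t ℕ.≤ f) → Dec (t ℕ.< u) →
        [ (t ℕ.≤? u) ×-dec (t ℕ.≤? f) ] - [ (suc t ℕ.≤? u) ×-dec (t ℕ.≤? f) ] ≡
        [ (f ℕ.≟ t) ×-dec (u ℕ.≟ t) ]
      by-value (no t≰f) _ = trans
        (cong₂ _-_ ([]-false ((t ℕ.≤? u) ×-dec (t ℕ.≤? f)) (t≰f ∘ proj₂))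
                   ([]-false ((suc t ℕ.≤? u) ×-dec (t ℕ.≤? f)) (t≰f ∘ proj₂)))
        (sym ([]-false ((f ℕ.≟ t) ×-dec (u ℕ.≟ t)) λ (f≡t , _) →
          t≰f (ℕ.≤-reflexive (sym f≡t))))
      by-value (yes t≤f) (yes t<u) = trans
        (cong₂ _-_ ([]-true ((t ℕ.≤? u) ×-dec (t ℕ.≤? f)) (ℕ.<⇒≤ t<u , t≤f))
                   ([]-true ((suc t ℕ.≤? u) ×-dec (t ℕ.≤? f)) (t<u , t≤f)))
        (sym ([]-false ((f ℕ.≟ t) ×-dec (u ℕ.≟ t)) λ (_ , u≡t) →
          ℕ.<-irrefl (sym u≡t) t<u))
      by-value (yes t≤f) (no t≮u) = trans
        (cong₂ _-_ ([]-true ((t ℕ.≤? u) ×-dec (t ℕ.≤? f)) (ℕ.≤-trans t≤f f≤u , t≤f))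
                   ([]-false ((suc t ℕ.≤? u) ×-dec (t ℕ.≤? f)) (t≮u ∘ proj₁)))
        (sym ([]-true ((f ℕ.≟ t) ×-dec (u ℕ.≟ t))
          (ℕ.≤-antisym (ℕ.≤-trans f≤u (ℕ.≮⇒≥ t≮u)) t≤f ,
           ℕ.≤-antisym (ℕ.≮⇒≥ t≮u) (ℕ.≤-trans t≤f f≤u))))

  -- An element spanned by F is spanned by every larger T, by submodularity at F ∪ ⁅ e ⁆ and T.
  rk-∪⁅⁆ : ∀ {F T e} → F ⊆ T → rk M (F ∪ ⁅ e ⁆) ℕ.≤ rk M F → rk M (T ∪ ⁅ e ⁆) ≡ rk M T
  rk-∪⁅⁆ {F} {T} {e} F⊆T e-spanned = ℕ.≤-antisym
    (ℕ.+-cancelʳ-≤ (rk M F) _ _ (begin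
      rk M (T ∪ ⁅ e ⁆) ℕ.+ rk M F
        ≤⟨ ℕ.+-mono-≤ (rk-mono T∪e⊆) (rk-mono F⊆) ⟩
      rk M ((F ∪ ⁅ e ⁆) ∪ T) ℕ.+ rk M ((F ∪ ⁅ e ⁆) ∩ T)
        ≤⟨ drop‿+≤+ (r-submodular (F ∪ ⁅ e ⁆) T) ⟩
      rk M (F ∪ ⁅ e ⁆) ℕ.+ rk M T
        ≤⟨ ℕ.+-monoˡ-≤ (rk M T) e-spanned ⟩
      rk M F ℕ.+ rk M T
        ≡⟨ ℕ.+-comm (rk M F) (rk M T) ⟩
      rk M T ℕ.+ rk M F ∎))
    (rk-mono {T} (p⊆p∪q ⁅ e ⁆))
    where
    open ℕ.≤-Reasoning
    T∪e⊆ : T ∪ ⁅ e ⁆ ⊆ (F ∪ ⁅ e ⁆) ∪ T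
    T∪e⊆ x∈ with x∈p∪q⁻ T ⁅ e ⁆ x∈
    ... | inj₁ x∈T = q⊆p∪q (F ∪ ⁅ e ⁆) T x∈T
    ... | inj₂ x∈e = p⊆p∪q T (q⊆p∪q F ⁅ e ⁆ x∈e)
    F⊆ : F ⊆ (F ∪ ⁅ e ⁆) ∩ T
    F⊆ x∈F = x∈p∩q⁺ (p⊆p∪q ⁅ e ⁆ x∈F , F⊆T x∈F)

  flatIndicator : ℕ → Subset (size E) → ℤ
  flatIndicator t F = ∑⊇ F (levelIndicator t F)

  -- The sets T ⊇ F with rk T = rk F are those between F and its closure, so
  -- the alternating sum over them vanishes unless F is closed.
  flatIndicator-≡ : ∀ t F → flatIndicator t F ≡ [ isFlatOfRank? M t F ]
  flatIndicator-≡ t F = trans (∑⊇-cong F λ T F⊆T → levelIndicator-≡ t F⊆T)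
    (cases (isFlatOfRank? M t F))
    where
    level : Subset (size E) → ℤ
    level T = [ (rk M F ℕ.≟ t) ×-dec (rk M T ℕ.≟ t) ]
    cases : (d : Dec (IsFlatOfRank M t F)) → ∑⊇ F level ≡ [ d ]
    cases (yes (flat , rk≡t)) = trans
      (∑⊇-head F λ T F⊆T {e} e∉F e∈T →
        []-false ((rk M F ℕ.≟ t) ×-dec (rk M T ℕ.≟ t)) λ (_ , rkT≡t) →
        ℕ.<⇒≱ (flat e e∉F) (ℕ.≤-trans (rk-mono (F∪e⊆ F⊆T e∈T))
          (ℕ.≤-reflexive (trans rkT≡t (sym rk≡t)))))
      ([]-true ((rk M F ℕ.≟ t) ×-dec (rk M F ℕ.≟ t)) (rk≡t , rk≡t))
      where
      F∪e⊆ : ∀ {T e} → F ⊆ T → e ∈ T → F ∪ ⁅ e ⁆ ⊆ T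
      F∪e⊆ {T} {e} F⊆T e∈T x∈ with x∈p∪q⁻ F ⁅ e ⁆ x∈
      ... | inj₁ x∈F = F⊆T x∈F
      ... | inj₂ x∈e rewrite x∈⁅y⁆⇒x≡y e x∈e = e∈T
    cases (no ¬flatOfRank) with rk M F ℕ.≟ t
    ... | no  rk≢t = ∑⊇-zero F λ T _ → []-false ((rk M F ℕ.≟ t) ×-dec (rk M T ℕ.≟ t)) (rk≢t ∘ proj₁)
    -- F has the right rank but is not closed. Decidability over the finite ground set yields an e
    -- outside F that does not raise its rank, and adding this e pairs off the sets T.
    ... | yes rk≡t
      with e , ¬grows ← Fin.¬∀⟶∃¬ _ (λ e → e ∉ F → rk M F ℕ.< rk M (F ∪ ⁅ e ⁆))
             (λ e → ¬? (e ∈? F) →-dec (rk M F ℕ.<? rk M (F ∪ ⁅ e ⁆)))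
             (λ flat → ¬flatOfRank (flat , rk≡t))
      = ∑⊇-cancel F {e = e}
          (λ e∈F → ¬grows λ e∉F → contradiction e∈F e∉F)
          (λ T F⊆T → cong (λ u → [ (rk M F ℕ.≟ t) ×-dec (u ℕ.≟ t) ])
            (rk-∪⁅⁆ F⊆T (ℕ.≮⇒≥ λ grows → ¬grows λ _ → grows)))

-- Linear combinations of matroids

module Combination {s : ℕ} (c : Fin s → ℤ) where

  -- For a linear relation with coefficients c, the families that it annihilates form an additive
  -- group, which is all that `Linearity` asks for.
  Vanishes : (Fin s → ℤ) → Set
  Vanishes a = ∑ (λ i → c i * a i) ≡ 0ℤ

  private
    ∑-neg : ∀ {m} (f : Vector ℤ m) → ∑ (λ i → - f i) ≡ - ∑ f
    ∑-neg {zero}  f = refl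
    ∑-neg {suc m} f = trans (cong (_+_ (- f zero)) (∑-neg (f ∘ suc)))
                            (sym (neg-distrib-+ (f zero) (∑ (f ∘ suc))))

  vanishes-cong : ∀ {a b} → (∀ i → a i ≡ b i) → Vanishes a → Vanishes b
  vanishes-cong a≡b a-van =
    trans (∑ℤ.sum-cong-≗ λ i → cong (_*_ (c i)) (sym (a≡b i))) a-van

  vanishes-0 : Vanishes λ _ → 0ℤ
  vanishes-0 = trans (∑ℤ.sum-cong-≗ λ i → *-zeroʳ (c i)) (∑ℤ.sum-replicate-zero s)

  vanishes-+ : ∀ {a b} → Vanishes a → Vanishes b → Vanishes λ i → a i + b i
  vanishes-+ {a} {b} a-van b-van =
    trans (∑ℤ.sum-cong-≗ λ i → *-distribˡ-+ (c i) (a i) (b i))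
      (trans (∑ℤ.∑-distrib-+ (λ i → c i * a i) (λ i → c i * b i)) (cong₂ _+_ a-van b-van))

  vanishes-neg : ∀ {a} → Vanishes a → Vanishes λ i → - a i
  vanishes-neg {a} a-van =
    trans (∑ℤ.sum-cong-≗ λ i → sym (neg-distribʳ-* (c i) (a i)))
      (trans (∑-neg (λ i → c i * a i)) (cong -_ a-van))

  vanishes-- : ∀ {a b} → Vanishes a → Vanishes b → Vanishes λ i → a i - b i
  vanishes-- {a} {b} a-van b-van = vanishes-+ {a} a-van (vanishes-neg {b} b-van)

  open Linearity Vanishes vanishes-0 (λ {a} {b} → vanishes-+ {a} {b})
    (λ {a} {b} → vanishes-- {a} {b}) public

  vanishes-∑⊇ : ∀ (F : Subset k) {g : Fin s → Subset k → ℤ} →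
                (∀ T → Vanishes λ i → g i T) → Vanishes λ i → ∑⊇ F (g i)
  vanishes-∑⊇ []            g-van = g-van []
  vanishes-∑⊇ (inside ∷ F)  g-van = vanishes-∑⊇ F (g-van ∘ (inside ∷_))
  vanishes-∑⊇ (outside ∷ F) {g} g-van =
    vanishes-- {λ i → ∑⊇ F (g i ∘ (outside ∷_))}
      (vanishes-∑⊇ F (g-van ∘ (outside ∷_))) (vanishes-∑⊇ F (g-van ∘ (inside ∷_)))

  vanishes-count : ∀ {A : Set} {P : Fin s → A → Set} (P? : ∀ i → U.Decidable (P i)) →
    (∀ x → Vanishes λ i → [ P? i x ]) → ∀ xs → Vanishes λ i → + length (filter (P? i) xs)
  vanishes-count P? P-van []       = vanishes-0
  vanishes-count P? P-van (x ∷ xs) = vanishes-cong (λ i → sym (count-∷ i))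
    (vanishes-+ {λ i → [ P? i x ]} (P-van x) (vanishes-count P? P-van xs))
    where
    count-∷ : ∀ i → + length (filter (P? i) (x ∷ xs)) ≡
                    [ P? i x ] + + length (filter (P? i) xs)
    count-∷ i with does (P? i x)
    ... | true  = refl
    ... | false = refl

-- Coefficients of Whitney polynomials, and the valuation property

coeff-∑ₚ : ∀ {m} (p : Vector Polynomial m) t → coeff (∑ₚ p) t ≡ ∑ (λ i → coeff (p i) t)
coeff-∑ₚ {zero}  p t = refl
coeff-∑ₚ {suc m} p t = cong (_+_ (coeff (p zero) t)) (coeff-∑ₚ (p ∘ suc) t)

coeff-×ₚ : ∀ n p t → coeff (n ×ₚ p) t ≡ + n * coeff p t
coeff-×ₚ zero    p t = refl
coeff-×ₚ (suc n) p t = trans (cong (_+_ (coeff p t)) (coeff-×ₚ n p t)) (l (+ n) (coeff p t))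
  where
  l : ∀ n c → c + n * c ≡ (1ℤ + n) * c
  l = solve-∀

coeff-· : ∀ c p t → coeff (_·_ ℤ[t] c p) t ≡ c * coeff p t
coeff-· (+ n)    p t = coeff-×ₚ n p t
coeff-· -[1+ n ] p t = trans (cong -_ (coeff-×ₚ (suc n) p t))
                             (neg-distribˡ-* (+ suc n) (coeff p t))

-- The hypothesis covers exponents beyond the range of the sum; for Whitney numbers these are the
-- exponents above the rank.
∑-select : ∀ m (f : ℕ → ℤ) t → (m ℕ.≤ t → f t ≡ 0ℤ) →
           ∑ {m} (λ i → if does (toℕ i ℕ.≟ t) then f (toℕ i) else 0ℤ) ≡ f t
∑-select zero    f t       f≡0 = sym (f≡0 ℕ.z≤n)
∑-select (suc m) f zero    f≡0 = trans (cong (_+_ (f 0)) (∑-zero m)) (+-identityʳ (f 0))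
  where
  ∑-zero : ∀ m → ∑ {m} (λ _ → 0ℤ) ≡ 0ℤ
  ∑-zero zero    = refl
  ∑-zero (suc m) = trans (+-identityˡ _) (∑-zero m)
∑-select (suc m) f (suc t) f≡0 =
  trans (+-identityˡ _) (∑-select m (f ∘ suc) t (f≡0 ∘ ℕ.s≤s))

whitneyNumber-beyond : ∀ {E} (M : Matroid E) t → rank M ℕ.< t → whitneyNumber M t ≡ 0
whitneyNumber-beyond M t rank<t = cong length
  (List.filter-none (isFlatOfRank? M t) {xs = subsets _}
    (All.universal (λ F (_ , rk≡t) → ℕ.<⇒≱ rank<t
      (subst (ℕ._≤ rank M) rk≡t (Rank.rk-mono M {F} ⊆⊤))) (subsets _)))

coeff-whitneyPolynomial : ∀ {E} (M : Matroid E) t →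
                          coeff (whitneyPolynomial E M) t ≡ + whitneyNumber M t
coeff-whitneyPolynomial M t =
  trans (coeff-∑ₚ {suc (rank M)} (λ i → (+ whitneyNumber M (toℕ i)) t^ toℕ i) t)
    (∑-select (suc (rank M)) (λ i → + whitneyNumber M i) t
      (cong +_ ∘ whitneyNumber-beyond M t))

whitney-valuation : IsValuation ℤ[t] whitneyPolynomial
whitney-valuation E s M c dependent t = begin
  coeff (∑ₚ (λ i → _·_ ℤ[t] (c i) (W i))) t
    ≡⟨ coeff-∑ₚ (λ i → _·_ ℤ[t] (c i) (W i)) t ⟩
  ∑ (λ i → coeff (_·_ ℤ[t] (c i) (W i)) t)
    ≡⟨ ∑ℤ.sum-cong-≗ (λ i → trans (coeff-· (c i) (W i) t)
         (cong (_*_ (c i)) (coeff-whitneyPolynomial (M i) t))) ⟩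
  ∑ (λ i → c i * + whitneyNumber (M i) t)
    ≡⟨ vanishes-count (λ i → isFlatOfRank? (M i) t) flats-vanish (subsets (size E)) ⟩
  0ℤ ∎
  where
  open ≡-Reasoning
  open Combination c
  W : Fin s → Polynomial
  W i = whitneyPolynomial E (M i)
  N : ℕ
  N = 2^ size E
  instance
    N≢0 : ℕ.NonZero N
    N≢0 = 2^-nonZero (size E)
  polytopes-vanish : ∀ z → Vanishes λ i → Flats.polytopeIndicator (M i) z
  -- The hypothesis asks for indicator values certified at a real point. At a grid point the
  -- decidable inequalities provide the certificate, with both directions of `Membership`
  -- translating to the real hull.
  polytopes-vanish z = dependent (fromℚ ∘ Scaled.point N {{N≢0}} z)
    (λ i → Flats.polytopeIndicator (M i) z) (λ i → indicator-at i (Flats.inBase? (M i) N z))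
    where
    indicator-at : ∀ i (d : Dec (Decomposition.InBase (M i) N z)) →
      Indicator (basePolytope (M i)) (fromℚ ∘ Scaled.point N {{N≢0}} z) [ d ]
    indicator-at i (yes z∈) = inside (Membership.inBase⇒∈ (M i) N {{N≢0}} {z} z∈)
    indicator-at i (no z∉)  = outside (z∉ ∘ Membership.∈⇒inBase (M i) N {{N≢0}} {z})
  chains-vanish : ∀ F T a b → Vanishes λ i → Flats.chainIndicator (M i) F T a b
  chains-vanish F T a b = V-χ (boundPlan₂ F T (+ a) (+ b)) polytopes-vanish
  flats-vanish : ∀ F → Vanishes λ i → [ isFlatOfRank? (M i) t F ]
  flats-vanish F = vanishes-cong (λ i → Flats.flatIndicator-≡ (M i) t F)
    (vanishes-∑⊇ F λ T → vanishes-- {λ i → Flats.chainIndicator (M i) F T t t}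
      (chains-vanish F T t t) (chains-vanish F T t (suc t)))

-- Isomorphism invariance

module _ {m n} (σ : Fin m ↔ Fin n) where
  open Inverse σ using (to; from; strictlyInverseˡ; strictlyInverseʳ)

  lookup-image : ∀ S i → lookup (image σ S) i ≡ lookup S (from i)
  lookup-image S i = Vec.lookup∘tabulate (lookup S ∘ from) i

  lookup-image-to : ∀ S i → lookup (image σ S) (to i) ≡ lookup S i
  lookup-image-to S i = trans (lookup-image S (to i)) (cong (lookup S) (strictlyInverseʳ i))

  from-∈ : ∀ {S i} → i ∈ image σ S → from i ∈ S
  from-∈ {S} {i} i∈ = lookup⇒[]= (from i) S (trans (sym (lookup-image S i)) ([]=⇒lookup i∈))

  ∈-image : ∀ {S i} → from i ∈ S → i ∈ image σ S
  ∈-image {S} {i} i∈ = lookup⇒[]= i (image σ S) (trans (lookup-image S i) ([]=⇒lookup i∈))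

  image-∩ : ∀ S T → image σ (S ∩ T) ≡ image σ S ∩ image σ T
  image-∩ S T = ⊆-antisym
    (λ i∈ → let i∈S , i∈T = x∈p∩q⁻ S T (from-∈ {S ∩ T} i∈) in
      x∈p∩q⁺ (∈-image {S} i∈S , ∈-image {T} i∈T))
    (λ i∈ → let i∈S , i∈T = x∈p∩q⁻ (image σ S) (image σ T) i∈ in
      ∈-image {S ∩ T} (x∈p∩q⁺ (from-∈ {S} i∈S , from-∈ {T} i∈T)))

  image-∪⁅⁆ : ∀ S i → image σ (S ∪ ⁅ from i ⁆) ≡ image σ S ∪ ⁅ i ⁆
  image-∪⁅⁆ S i = ⊆-antisym left right
    where
    left : image σ (S ∪ ⁅ from i ⁆) ⊆ image σ S ∪ ⁅ i ⁆
    left {j} j∈ with x∈p∪q⁻ S ⁅ from i ⁆ (from-∈ j∈)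
    ... | inj₁ j∈S = p⊆p∪q ⁅ i ⁆ (∈-image j∈S)
    ... | inj₂ j∈i = q⊆p∪q (image σ S) ⁅ i ⁆ (subst (_∈ ⁅ i ⁆) (sym j≡i) (x∈⁅x⁆ i))
      where
      j≡i : j ≡ i
      j≡i = trans (sym (strictlyInverseˡ j))
        (trans (cong to (x∈⁅y⁆⇒x≡y (from i) j∈i)) (strictlyInverseˡ i))
    right : image σ S ∪ ⁅ i ⁆ ⊆ image σ (S ∪ ⁅ from i ⁆)
    right {j} j∈ with x∈p∪q⁻ (image σ S) ⁅ i ⁆ j∈
    ... | inj₁ j∈S = ∈-image {S ∪ ⁅ from i ⁆} (p⊆p∪q ⁅ from i ⁆ (from-∈ {S} j∈S))
    ... | inj₂ j∈i = ∈-image {S ∪ ⁅ from i ⁆} (q⊆p∪q S ⁅ from i ⁆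
      (subst (λ e → from e ∈ ⁅ from i ⁆) (sym (x∈⁅y⁆⇒x≡y i j∈i)) (x∈⁅x⁆ (from i))))

  image-image-sym : ∀ S → image σ (image (↔-sym σ) S) ≡ S
  image-image-sym S = ⊆-antisym
    (λ {i} i∈ → lookup⇒[]= i S (trans (sym (eq i)) ([]=⇒lookup i∈)))
    (λ {i} i∈ → lookup⇒[]= i _ (trans (eq i) ([]=⇒lookup i∈)))
    where
    eq : ∀ i → lookup (image σ (image (↔-sym σ) S)) i ≡ lookup S i
    eq i = trans (lookup-image (image (↔-sym σ) S) i)
      (trans (Vec.lookup∘tabulate (lookup S ∘ to) (from i)) (cong (lookup S) (strictlyInverseˡ i)))

  private
    bit : Bool → ℕ
    bit s = if s then 1 else 0

    ∣∣-∑ : ∀ {k} (S : Subset k) → ∣ S ∣ ≡ ∑ℕ (λ i → bit (lookup S i))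
    ∣∣-∑ []            = refl
    ∣∣-∑ (outside ∷ S) = ∣∣-∑ S
    ∣∣-∑ (inside ∷ S)  = cong suc (∣∣-∑ S)

  ∣image∣ : ∀ S → ∣ image σ S ∣ ≡ ∣ S ∣
  ∣image∣ S = begin
    ∣ image σ S ∣                                   ≡⟨ ∣∣-∑ (image σ S) ⟩
    ∑ℕ (λ i → bit (lookup (image σ S) i))           ≡⟨ ∑ℕ.sum-permute (λ i → bit (lookup (image σ S) i)) σ ⟩
    ∑ℕ (λ i → bit (lookup (image σ S) (to i)))      ≡⟨ ∑ℕ.sum-cong-≗ (λ i → cong bit (lookup-image-to S i)) ⟩
    ∑ℕ (λ i → bit (lookup S i))                     ≡⟨ ∣∣-∑ S ⟨
    ∣ S ∣                                           ∎
    where open ≡-Reasoning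

unique-subsets : ∀ n → Unique (subsets n)
unique-subsets zero    = All.[] AllPairs.∷ AllPairs.[]
unique-subsets (suc n) = Unique.++⁺
  (Unique.map⁺ Vec.∷-injectiveʳ (unique-subsets n))
  (Unique.map⁺ Vec.∷-injectiveʳ (unique-subsets n))
  λ (∈out , ∈in) → disjoint (List.∈-map⁻ (outside ∷_) ∈out) (List.∈-map⁻ (inside ∷_) ∈in)
  where
  disjoint : ∀ {S : Subset (suc n)} →
    ∃ (λ T → T List.∈ subsets n × S ≡ outside ∷ T) →
    ¬ ∃ (λ T → T List.∈ subsets n × S ≡ inside ∷ T)
  disjoint (_ , _ , refl) (_ , _ , ())

≅-sym : ∀ {E E′} {M : Matroid E} {N : Matroid E′} → M ≅ N → N ≅ M
≅-sym {N = N} (σ , bases) = ↔-sym σ , λ B → mk⇔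
  (λ B-basis → Equivalence.from (bases (image (↔-sym σ) B))
    (subst (Matroid.IsBasis N) (sym (image-image-sym σ B)) B-basis))
  (λ B-basis → subst (Matroid.IsBasis N) (image-image-sym σ B)
    (Equivalence.to (bases (image (↔-sym σ) B)) B-basis))

rk≤rk-image : ∀ {E E′} (M : Matroid E) (N : Matroid E′) ((σ , _) : M ≅ N) →
              ∀ S → rk M S ℕ.≤ rk N (image σ S)
rk≤rk-image M N (σ , bases) S with B , B-basis , eq ← Rank.rk-attained M S = begin
  rk M S                        ≡⟨ eq ⟩
  ∣ S ∩ B ∣                     ≡⟨ ∣image∣ σ (S ∩ B) ⟨
  ∣ image σ (S ∩ B) ∣           ≡⟨ cong ∣_∣ (image-∩ σ S B) ⟩
  ∣ image σ S ∩ image σ B ∣     ≤⟨ Rank.rk-upper N (image σ S) (Equivalence.to (bases B) B-basis) ⟩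
  rk N (image σ S)              ∎
  where open ℕ.≤-Reasoning

-- The inequality for the isomorphism and the one for its inverse give equality.
rk-image : ∀ {E E′} (M : Matroid E) (N : Matroid E′) ((σ , _) : M ≅ N) →
           ∀ S → rk N (image σ S) ≡ rk M S
rk-image M N iso@(σ , _) S = ℕ.≤-antisym
  (subst (λ T → rk N (image σ S) ℕ.≤ rk M T) (image-image-sym (↔-sym σ) S)
    (rk≤rk-image N M (≅-sym {M = M} {N = N} iso) (image σ S)))
  (rk≤rk-image M N iso S)

image-isFlatOfRank : ∀ {E E′} (M : Matroid E) (N : Matroid E′) ((σ , _) : M ≅ N) →
  ∀ {t F} → IsFlatOfRank M t F → IsFlatOfRank N t (image σ F)
image-isFlatOfRank M N iso@(σ , _) {t} {F} (flat , rk≡t) =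
  (λ e e∉ → subst₂ ℕ._<_ (sym (rk-image M N iso F))
    (trans (sym (rk-image M N iso (F ∪ ⁅ Inverse.from σ e ⁆))) (cong (rk N) (image-∪⁅⁆ σ F e)))
    (flat (Inverse.from σ e) (e∉ ∘ ∈-image σ))) ,
  trans (rk-image M N iso F) rk≡t

-- Both lists of flats are free of repetitions. The image of one has the same members as the other,
-- so they are permutations of each other and equally long.
whitneyNumber-≅ : ∀ {E E′} (M : Matroid E) (N : Matroid E′) → M ≅ N →
                  ∀ t → whitneyNumber M t ≡ whitneyNumber N t
whitneyNumber-≅ {E} {E′} M N iso@(σ , _) t =
  trans (sym (List.length-map (image σ) flatsM))
    (↭-length (∼bag⇒↭ (unique∧set⇒bag
      (Unique.map⁺ image-injective (Unique.filter⁺ (isFlatOfRank? M t) (unique-subsets (size E))))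
      (Unique.filter⁺ (isFlatOfRank? N t) (unique-subsets (size E′)))
      (mk⇔ forwards backwards))))
  where
  flatsM : List (Subset (size E))
  flatsM = filter (isFlatOfRank? M t) (subsets (size E))
  flatsN : List (Subset (size E′))
  flatsN = filter (isFlatOfRank? N t) (subsets (size E′))
  image-injective : ∀ {S T} → image σ S ≡ image σ T → S ≡ T
  image-injective {S} {T} eq = trans (sym (image-image-sym (↔-sym σ) S))
    (trans (cong (image (↔-sym σ)) eq) (image-image-sym (↔-sym σ) T))
  forwards : ∀ {G} → G List.∈ List.map (image σ) flatsM → G List.∈ flatsN
  forwards G∈ with F , F∈ , refl ← List.∈-map⁻ (image σ) G∈ =
    List.∈-filter⁺ (isFlatOfRank? N t) (∈-subsets (image σ F))
      (image-isFlatOfRank M N iso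
        (proj₂ (List.∈-filter⁻ (isFlatOfRank? M t) {xs = subsets (size E)} F∈)))
  backwards : ∀ {G} → G List.∈ flatsN → G List.∈ List.map (image σ) flatsM
  backwards {G} G∈ = subst (List._∈ List.map (image σ) flatsM) (image-image-sym σ G)
    (List.∈-map⁺ (image σ) (List.∈-filter⁺ (isFlatOfRank? M t) (∈-subsets (image (↔-sym σ) G))
      (image-isFlatOfRank N M (≅-sym {M = M} {N = N} iso)
        (proj₂ (List.∈-filter⁻ (isFlatOfRank? N t) {xs = subsets (size E′)} G∈)))))

whitney-invariant : IsInvariant ℤ[t] whitneyPolynomial
whitney-invariant M N iso t = trans (coeff-whitneyPolynomial M t)
  (trans (cong +_ (whitneyNumber-≅ M N iso t)) (sym (coeff-whitneyPolynomial N t)))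

corollary8p4 : IsValuativeInvariant ℤ[t] whitneyPolynomial
corollary8p4 = whitney-valuation , λ {E} {E′} → whitney-invariant {E} {E′}
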